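{- Let $\Gamma$ be a connected strongly regular graph with parameters $(v,k,\lambda,\mu)$, with Laplacian $L$, whose two distinct nonzero Laplacian eigenvalues $r$ and $s$ are integers, with multiplicities $f$ and $g$ respectively. Let $p$ be a prime dividing $|K(\Gamma)|$. Suppose $p \nmid r$, and let $a,\gamma$ be the unique nonnegative integers with $p^a \parallel s$ and $p^\gamma \parallel v$. Then \[ K_p(\Gamma) \cong \mathbb{Z}/p^{a-\gamma}\mathbb{Z} \oplus (\mathbb{Z}/p^a\mathbb{Z})^{g-1}. \] The same statement holds with the roles of $r$ and $s$ interchanged and the roles of $f$ and $g$ interchanged.
   Context: A graph is strongly regular with parameters $(v,k,\lambda,\mu)$ if it has $v$ vertices, is $k$-regular, any two adjacent vertices have exactly $\lambda$ common neighbours, and any two non-adjacent vertices have exactly $\mu$ common neighbours. The Laplacian is $L = kI - A$ with $A$ the adjacency matrix. For a connected strongly regular graph (not complete), $0$ is a simple eigenvalue of $L$ and $L$ has exactly two other distinct eigenvalues $r,s$. Viewing $L$ as a map $\mathbb{Z}^{\mathcal{V}} \to \mathbb{Z}^{\mathcal{V}}$, its cokernel decomposes as $K(\Gamma) \oplus \mathbb{Z}$ with $K(\Gamma)$ a finite abelian group, the critical group of $\Gamma$. $K_p(\Gamma)$ denotes the Sylow $p$-subgroup of $K(\Gamma)$. Notation $p^i \parallel n$ means $p^i \mid n$ and $p^{i+1} \nmid n$; $\mathbb{Z}/p^0\mathbb{Z}$ is the trivial group. -}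

module Defs where

open import Data.Nat as ℕ using (ℕ; zero; suc; _^_; _∸_; _≤_)
open import Data.Nat.Divisibility as ℕD using ()
open import Data.Integer as ℤ using (ℤ; +_)
open import Data.Integer.Divisibility as ℤD using ()
open import Data.Rational as ℚ using (ℚ; 0ℚ)
open import Data.Fin using (Fin; zero; suc; _≟_)
open import Data.Bool using (Bool; true; false; if_then_else_)
open import Data.Product using (Σ; ∃; _×_; _,_)
open import Relation.Nullary using (¬_; does)
open import Relation.Binary.PropositionalEquality using (_≡_; _≢_)

record Graph (v : ℕ) : Set where
  field
    adj   : Fin v → Fin v → Bool
    sym   : ∀ i j → adj i j ≡ adj j i
    irrefl : ∀ i → adj i i ≡ false
open Graph public

sumℕ : (n : ℕ) → (Fin n → ℕ) → ℕ
sumℕ zero    f = 0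
sumℕ (suc n) f = f zero ℕ.+ sumℕ n (λ i → f (suc i))

sumℤ : (n : ℕ) → (Fin n → ℤ) → ℤ
sumℤ zero    f = + 0
sumℤ (suc n) f = f zero ℤ.+ sumℤ n (λ i → f (suc i))

sumℚ : (n : ℕ) → (Fin n → ℚ) → ℚ
sumℚ zero    f = 0ℚ
sumℚ (suc n) f = f zero ℚ.+ sumℚ n (λ i → f (suc i))

b2n : Bool → ℕ
b2n true  = 1
b2n false = 0

degree : ∀ {v} → Graph v → Fin v → ℕ
degree {v} Γ i = sumℕ v (λ j → b2n (adj Γ i j))

common : ∀ {v} → Graph v → Fin v → Fin v → ℕ
common {v} Γ i j = sumℕ v (λ l → b2n (adj Γ i l Data.Bool.∧ adj Γ j l))

IsSRG : ∀ {v} → Graph v → ℕ → ℕ → ℕ → Set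
IsSRG {v} Γ k λ' μ =
  (∀ i → degree Γ i ≡ k) ×
  (∀ i j → adj Γ i j ≡ true → common Γ i j ≡ λ') ×
  (∀ i j → i ≢ j → adj Γ i j ≡ false → common Γ i j ≡ μ)

data Reach {v} (Γ : Graph v) : Fin v → Fin v → Set where
  here : ∀ {i} → Reach Γ i i
  step : ∀ {i j l} → adj Γ i j ≡ true → Reach Γ j l → Reach Γ i l

Connected : ∀ {v} → Graph v → Set
Connected {v} Γ = ∀ (i j : Fin v) → Reach Γ i j

adjMat : ∀ {v} → Graph v → Fin v → Fin v → ℤ
adjMat Γ i j = + b2n (adj Γ i j)

laplacian : ∀ {v} → Graph v → ℕ → Fin v → Fin v → ℤ
laplacian Γ k i j = (if does (i ≟ j) then + k else + 0) ℤ.- adjMat Γ i j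

actℤ : ∀ {v} → (Fin v → Fin v → ℤ) → (Fin v → ℤ) → Fin v → ℤ
actℤ {v} M x i = sumℤ v (λ j → M i j ℤ.* x j)

toℚ : ℤ → ℚ
toℚ z = z ℚ./ 1

actℚ : ∀ {v} → (Fin v → Fin v → ℤ) → (Fin v → ℚ) → Fin v → ℚ
actℚ {v} M x i = sumℚ v (λ j → toℚ (M i j) ℚ.* x j)

InEigenspace : ∀ {v} → (Fin v → Fin v → ℤ) → ℤ → (Fin v → ℚ) → Set
InEigenspace M r x = ∀ i → actℚ M x i ≡ toℚ r ℚ.* x i

LinIndep : ∀ {v m} → (Fin m → Fin v → ℚ) → Set
LinIndep {v} {m} b =
  ∀ (c : Fin m → ℚ) → (∀ j → sumℚ m (λ i → c i ℚ.* b i j) ≡ 0ℚ) → ∀ i → c i ≡ 0ℚ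

EigenMult : ∀ {v} → (Fin v → Fin v → ℤ) → ℤ → ℕ → Set
EigenMult {v} M r f =
  (Σ (Fin f → Fin v → ℚ) λ b → (∀ i → InEigenspace M r (b i)) × LinIndep b) ×
  (∀ (b : Fin (suc f) → Fin v → ℚ) → (∀ i → InEigenspace M r (b i)) → ¬ LinIndep b)

InImage : ∀ {v} → (Fin v → Fin v → ℤ) → (Fin v → ℤ) → Set
InImage {v} M x = ∃ λ (z : Fin v → ℤ) → ∀ i → actℤ M z i ≡ x i

scale : ∀ {v} → ℕ → (Fin v → ℤ) → Fin v → ℤ
scale m x i = + m ℤ.* x i

_-ᵥ_ : ∀ {v} → (Fin v → ℤ) → (Fin v → ℤ) → Fin v → ℤ
(x -ᵥ y) i = x i ℤ.- y i

CokerEq : ∀ {v} → (Fin v → Fin v → ℤ) → (Fin v → ℤ) → (Fin v → ℤ) → Set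
CokerEq M x y = InImage M (x -ᵥ y)

-- K(Γ) = torsion subgroup of coker L (representatives: x with m x ∈ im L, m ≥ 1),
-- elements taken modulo im L.
InK : ∀ {v} → (Fin v → Fin v → ℤ) → (Fin v → ℤ) → Set
InK M x = ∃ λ m → (1 ≤ m) × InImage M (scale m x)

InKp : ∀ {v} → (Fin v → Fin v → ℤ) → ℕ → (Fin v → ℤ) → Set
InKp M p x = ∃ λ n → InImage M (scale (p ^ n) x)

HasOrder : ∀ {v} → (Fin v → Fin v → ℤ) → ℕ → Set
HasOrder {v} M n = Σ (Fin n → Fin v → ℤ) λ e →
  (∀ i → InK M (e i)) ×
  (∀ i j → CokerEq M (e i) (e j) → i ≡ j) ×
  (∀ x → InK M x → ∃ λ i → CokerEq M x (e i))

ExactPow : ℕ → ℕ → ℕ → Set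
ExactPow p i n = ((p ^ i) ℕD.∣ n) × ¬ ((p ^ suc i) ℕD.∣ n)

-- exponents of the target group  ℤ/p^(a-γ) ⊕ (ℤ/p^a)^(g-1)  (indexed by Fin g)
targetExp : ∀ {g} → ℕ → ℕ → Fin g → ℕ
targetExp a γ zero    = a ∸ γ
targetExp a γ (suc _) = a

_+ᵥ_ : ∀ {m} → (Fin m → ℤ) → (Fin m → ℤ) → Fin m → ℤ
(x +ᵥ y) i = x i ℤ.+ y i

-- An isomorphism  (⊕_{i<g} ℤ/p^(e i)ℤ)  ≅  K_p  , where K_p ⊆ coker L.
-- Given by a group homomorphism ψ : ℤ^g → ℤ^v landing in (representatives of) K_p,
-- whose induced map ℤ^g → K_p is surjective and has kernel exactly ⊕ p^(e i)ℤ.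
IsoToKp : ∀ {v g} → (Fin v → Fin v → ℤ) → ℕ → (Fin g → ℕ) → Set
IsoToKp {v} {g} M p e = Σ ((Fin g → ℤ) → Fin v → ℤ) λ ψ →
  (∀ y y' j → ψ (y +ᵥ y') j ≡ ψ y j ℤ.+ ψ y' j) ×
  (∀ y → InKp M p (ψ y)) ×
  (∀ y → InImage M (ψ y) → ∀ i → (+ (p ^ e i)) ℤD.∣ y i) ×
  (∀ y → (∀ i → (+ (p ^ e i)) ℤD.∣ y i) → InImage M (ψ y)) ×
  (∀ x → InKp M p x → ∃ λ y → CokerEq M x (ψ y))

{-# OPTIONS --safe #-}
-- The Laplacian satisfies (L - r)(L - s) = μJ with rs = μv.  Over ℤ localised
-- at p, the module Y of sum-zero vectors splits into its r- and s-eigenlattices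
-- (p divides s but not r; if p divides neither, K_p = 0), so Y / L Y is
-- Λ / p^a Λ for the s-eigenlattice Λ.  The image of L is generated by L Y and
-- one further vector L δ, whose Λ-component is, up to units, p^(a-γ) w with
-- w = v (L - r) δ + r 1.  If p divides v then w is nonzero modulo p, so it
-- extends to a basis of Λ, and K_p = Λ / (p^a Λ + p^(a-γ) w); if p does not
-- divide v then p^(a-γ) w lies in p^a Λ already.

module Submission where

open import Defs renaming (sym to adj-sym)
open import Data.Nat as ℕ using (ℕ; zero; suc; _<_; _^_; _∸_)
import Data.Nat.Properties as ℕP
open import Data.Nat.Divisibility as ℕD using (_∣_)
open import Data.Nat.Primality using (Prime; euclidsLemma; prime⇒irreducible; prime⇒nonZero; prime⇒nonTrivial)
import Data.Nat.Coprimality as Coprimality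
open import Data.Nat.GCD using (module Bézout)
open import Data.Integer as ℤ using (ℤ; +_; ∣_∣; _+_; _*_; _-_; -_; 0ℤ; 1ℤ)
import Data.Integer.Properties as ℤP
open import Data.Integer.Divisibility.Signed as S using (divides) renaming (_∣_ to _∣ℤ_)
open import Data.Integer.Solver using (module +-*-Solver)
open import Data.Rational as ℚ using (ℚ; 0ℚ; mkℚ)
import Data.Rational.Properties as ℚP
open import Data.Rational.Unnormalised as ℚᵘ using (mkℚᵘ; *≡*)
import Data.Rational.Unnormalised.Properties as ℚᵘP
open import Data.Fin as Fin using (Fin; zero; suc; punchIn; punchOut)
open import Data.Fin.Properties using (all?; punchIn-punchOut; ¬∀⟶∃¬)
open import Data.Vec.Functional using (_∷_)
open import Data.Bool using (true; false; if_then_else_; _∧_)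
open import Data.Product using (∃; ∃₂; _×_; _,_; proj₁; proj₂)
open import Data.Sum using (_⊎_; inj₁; inj₂; [_,_]′)
open import Function using (_∘_; id)
open import Relation.Nullary using (¬_; yes; no; does; contradiction)
open import Relation.Binary.PropositionalEquality using (_≡_; _≢_; refl; sym; trans; cong; cong₂; subst; module ≡-Reasoning)
open +-*-Solver using (solve; _:=_; _:+_; _:*_; _:-_; :-_; con)
open ≡-Reasoning

-- Integer linear algebra

-- On sum-zero vectors (L - r)(L - s) vanishes, and s - r is prime to p once p divides s, so (L - r)
-- / (s - r) is a projection defined locally at p. On the r-eigenlattice L is multiplication by a
-- unit, which is why only Λ matters. The obstacle is the index v of Y plus constants in ℤ^v: the
-- projection of δ to the s-eigenspace has denominator v, although L δ is integral. From (L - r) L δ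
-- = s (L - r) δ + μ 1 and rs = μv one gets v (L - r) L δ = s w, and cancelling p^γ leaves p^(a-γ) w
-- up to units. This is where the exceptional exponent comes from. That w survives modulo p is
-- visible at once, since each of its entries is r modulo v. No localised ring is constructed.
-- Relations are multiplied by integers prime to p, and Bézout divides by them again at the end,
-- which is possible because each element of K_p is killed by a power of p. Since g is defined over
-- ℚ, the size of a local basis has to be compared with it separately, by one inequality in each
-- direction.

Vect : ℕ → Set
Vect n = Fin n → ℤ

sum-cong : ∀ n {f g : Vect n} → (∀ i → f i ≡ g i) → sumℤ n f ≡ sumℤ n g
sum-cong zero    f≗g = refl
sum-cong (suc n) f≗g = cong₂ _+_ (f≗g zero) (sum-cong n (f≗g ∘ suc))

sum-zero : ∀ n {f : Vect n} → (∀ i → f i ≡ 0ℤ) → sumℤ n f ≡ 0ℤ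
sum-zero zero    f≗0 = refl
sum-zero (suc n) f≗0 = cong₂ _+_ (f≗0 zero) (sum-zero n (f≗0 ∘ suc))

sum-+ : ∀ n (f g : Vect n) → sumℤ n (λ i → f i + g i) ≡ sumℤ n f + sumℤ n g
sum-+ zero    f g = refl
sum-+ (suc n) f g = trans (cong (_+_ (f zero + g zero)) (sum-+ n (f ∘ suc) (g ∘ suc)))
  (solve 4 (λ a b c d → (a :+ b) :+ (c :+ d) := (a :+ c) :+ (b :+ d)) refl
     (f zero) (g zero) (sumℤ n (f ∘ suc)) (sumℤ n (g ∘ suc)))

sum-* : ∀ n c (f : Vect n) → sumℤ n (λ i → c * f i) ≡ c * sumℤ n f
sum-* zero    c f = sym (ℤP.*-zeroʳ c)
sum-* (suc n) c f = trans (cong (_+_ (c * f zero)) (sum-* n c (f ∘ suc)))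
  (sym (ℤP.*-distribˡ-+ c (f zero) (sumℤ n (f ∘ suc))))

sum-swap : ∀ m n (f : Fin m → Fin n → ℤ) →
  sumℤ m (λ i → sumℤ n (f i)) ≡ sumℤ n (λ j → sumℤ m (λ i → f i j))
sum-swap zero    n f = sym (sum-zero n (λ _ → refl))
sum-swap (suc m) n f = trans (cong (_+_ (sumℤ n (f zero))) (sum-swap m n (f ∘ suc)))
  (sym (sum-+ n (f zero) (λ j → sumℤ m (λ i → f (suc i) j))))

sum-const : ∀ n c → sumℤ n (λ _ → c) ≡ + n * c
sum-const zero    c = refl
sum-const (suc n) c = trans (cong (_+_ c) (sum-const n c)) (sym (ℤP.suc-* (+ n) c))

sum-∣ : ∀ {d} n {f : Vect n} → (∀ i → d ∣ℤ f i) → d ∣ℤ sumℤ n f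
sum-∣ zero    d∣f = divides 0ℤ refl
sum-∣ (suc n) d∣f = S.∣m∣n⇒∣m+n (d∣f zero) (sum-∣ n (d∣f ∘ suc))

δ : ∀ {n} → Fin n → Fin n → ℤ
δ i j = if does (i Fin.≟ j) then 1ℤ else 0ℤ

sum-δ : ∀ {n} (x : Vect n) j → sumℤ n (λ i → x i * δ i j) ≡ x j
sum-δ {suc n} x zero = begin
  x zero * 1ℤ + sumℤ n (λ i → x (suc i) * 0ℤ) ≡⟨ cong₂ _+_ (ℤP.*-identityʳ (x zero)) (sum-zero n λ i → ℤP.*-zeroʳ (x (suc i))) ⟩
  x zero + 0ℤ                                 ≡⟨ ℤP.+-identityʳ (x zero) ⟩
  x zero                                      ∎
sum-δ {suc n} x (suc j) = begin
  x zero * 0ℤ + sumℤ n (λ i → x (suc i) * δ i j) ≡⟨ cong₂ _+_ (ℤP.*-zeroʳ (x zero)) (sum-δ (x ∘ suc) j) ⟩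
  0ℤ + x (suc j)                                 ≡⟨ ℤP.+-identityˡ _ ⟩
  x (suc j)                                      ∎

δ-comm : ∀ {n} (i j : Fin n) → δ i j ≡ δ j i
δ-comm zero    zero    = refl
δ-comm zero    (suc j) = refl
δ-comm (suc i) zero    = refl
δ-comm (suc i) (suc j) = δ-comm i j

*-cancel-zero : ∀ a {b} → a ≢ 0ℤ → a * b ≡ 0ℤ → b ≡ 0ℤ
*-cancel-zero a a≢0 ab≡0 = [ (λ a≡0 → contradiction a≡0 a≢0) , id ]′ (ℤP.i*j≡0⇒i≡0∨j≡0 a ab≡0)

lc : ∀ {m n} → Vect m → (Fin m → Vect n) → Vect n
lc {m} c b j = sumℤ m (λ i → c i * b i j)

lc-+ : ∀ {m n} (c d : Vect m) (b : Fin m → Vect n) j →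
  lc (λ i → c i + d i) b j ≡ lc c b j + lc d b j
lc-+ {m} c d b j = trans (sum-cong m λ i → ℤP.*-distribʳ-+ (b i j) (c i) (d i)) (sum-+ m _ _)

lc-* : ∀ {m n} u (c : Vect m) (b : Fin m → Vect n) j → lc (λ i → u * c i) b j ≡ u * lc c b j
lc-* {m} u c b j = trans (sum-cong m λ i → ℤP.*-assoc u (c i) (b i j)) (sum-* m u _)

lc-zero : ∀ {m n} {c : Vect m} (b : Fin m → Vect n) → (∀ i → c i ≡ 0ℤ) → ∀ j → lc c b j ≡ 0ℤ
lc-zero {m} b c≗0 j = sum-zero m λ i → cong (_* b i j) (c≗0 i)

lc-cong : ∀ {m n} {c d : Vect m} (b : Fin m → Vect n) → (∀ i → c i ≡ d i) → ∀ j → lc c b j ≡ lc d b j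
lc-cong {m} b c≗d j = sum-cong m λ i → cong (_* b i j) (c≗d i)

module _ {v : ℕ} (M : Fin v → Fin v → ℤ) where

  act-cong : ∀ {x y : Vect v} → (∀ i → x i ≡ y i) → ∀ i → actℤ M x i ≡ actℤ M y i
  act-cong x≗y i = sum-cong v λ j → cong (M i j *_) (x≗y j)

  act-+ : ∀ (x y : Vect v) i → actℤ M (λ j → x j + y j) i ≡ actℤ M x i + actℤ M y i
  act-+ x y i = trans (sum-cong v λ j → ℤP.*-distribˡ-+ (M i j) (x j) (y j)) (sum-+ v _ _)

  act-* : ∀ c (x : Vect v) i → actℤ M (λ j → c * x j) i ≡ c * actℤ M x i
  act-* c x i = trans
    (sum-cong v λ j → solve 3 (λ a b c → a :* (b :* c) := b :* (a :* c)) refl (M i j) c (x j))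
    (sum-* v c _)

  act-lin : ∀ a b (x y : Vect v) i →
    actℤ M (λ j → a * x j + b * y j) i ≡ a * actℤ M x i + b * actℤ M y i
  act-lin a b x y i = trans (act-+ _ _ i) (cong₂ _+_ (act-* a x i) (act-* b y i))

  act-lc : ∀ {m} (c : Vect m) (b : Fin m → Vect v) i → actℤ M (lc c b) i ≡ lc c (λ l → actℤ M (b l)) i
  act-lc {m} c b i = begin
    sumℤ v (λ j → M i j * lc c b j)                       ≡⟨ sum-cong v (λ j → sum-* m (M i j) _) ⟨
    sumℤ v (λ j → sumℤ m (λ l → M i j * (c l * b l j)))   ≡⟨ sum-swap v m _ ⟩
    sumℤ m (λ l → actℤ M (λ j → c l * b l j) i)           ≡⟨ sum-cong m (λ l → act-* (c l) (b l) i) ⟩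
    lc c (λ l → actℤ M (b l)) i                           ∎

  record Eigen (θ : ℤ) (x : Vect v) : Set where
    constructor eigen
    field act-eigen : ∀ i → actℤ M x i ≡ θ * x i

  open Eigen public

  eigen-lin : ∀ {θ} a b {x y : Vect v} → Eigen θ x → Eigen θ y → Eigen θ (λ j → a * x j + b * y j)
  eigen-lin {θ} a b {x} {y} (eigen ex) (eigen ey) = eigen λ i → begin
    actℤ M (λ j → a * x j + b * y j) i ≡⟨ act-lin a b x y i ⟩
    a * actℤ M x i + b * actℤ M y i    ≡⟨ cong₂ (λ p q → a * p + b * q) (ex i) (ey i) ⟩
    a * (θ * x i) + b * (θ * y i)      ≡⟨ solve 5 (λ a b t x y → a :* (t :* x) :+ b :* (t :* y) := t :* (a :* x :+ b :* y)) refl a b θ (x i) (y i) ⟩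
    θ * (a * x i + b * y i)            ∎

  eigen-lc : ∀ {θ m} (c : Vect m) {b : Fin m → Vect v} → (∀ l → Eigen θ (b l)) → Eigen θ (lc c b)
  eigen-lc {θ} {m} c {b} eb = eigen λ i → begin
    actℤ M (lc c b) i                  ≡⟨ act-lc c b i ⟩
    sumℤ m (λ l → c l * actℤ M (b l) i) ≡⟨ sum-cong m (λ l → trans (cong (c l *_) (act-eigen (eb l) i)) (solve 3 (λ a b c → a :* (b :* c) := b :* (a :* c)) refl (c l) θ (b l i))) ⟩
    sumℤ m (λ l → θ * (c l * b l i))   ≡⟨ sum-* m θ _ ⟩
    θ * lc c b i                       ∎

  eigen-cancel : ∀ {θ} d {x : Vect v} → d ≢ 0ℤ → Eigen θ (λ j → d * x j) → Eigen θ x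
  eigen-cancel {θ} d {x} d≢0 (eigen edx) = eigen λ i → ℤP.*-cancelˡ-≡ d _ _ {{ℤ.≢-nonZero d≢0}} (begin
    d * actℤ M x i          ≡⟨ act-* d x i ⟨
    actℤ M (λ j → d * x j) i ≡⟨ edx i ⟩
    θ * (d * x i)           ≡⟨ solve 3 (λ a b c → a :* (b :* c) := b :* (a :* c)) refl θ d (x i) ⟩
    d * (θ * x i)           ∎)

  eigen-cong : ∀ {θ} {x y : Vect v} → (∀ i → x i ≡ y i) → Eigen θ x → Eigen θ y
  eigen-cong {θ} x≗y (eigen ex) = eigen λ i → trans (sym (act-cong x≗y i)) (trans (ex i) (cong (θ *_) (x≗y i)))

  eigen⇒sum-zero : (∀ x → sumℤ v (actℤ M x) ≡ 0ℤ) → ∀ {θ x} → θ ≢ 0ℤ → Eigen θ x → sumℤ v x ≡ 0ℤ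
  eigen⇒sum-zero image-sum {θ} {x} θ≢0 ex = *-cancel-zero θ θ≢0 (begin
    θ * sumℤ v x            ≡⟨ sum-* v θ x ⟨
    sumℤ v (λ i → θ * x i)  ≡⟨ sum-cong v (act-eigen ex) ⟨
    sumℤ v (actℤ M x)       ≡⟨ image-sum x ⟩
    0ℤ                      ∎)

-- Linear independence and fraction-free elimination

Independent : ∀ {m n} → (Fin m → Vect n) → Set
Independent b = ∀ c → (∀ j → lc c b j ≡ 0ℤ) → ∀ i → c i ≡ 0ℤ

private
  vanishing? : ∀ {n} (x : Vect n) → (∀ j → x j ≡ 0ℤ) ⊎ ∃ λ j → x j ≢ 0ℤ
  vanishing? {n} x with all? (λ j → x j ℤ.≟ 0ℤ)
  ... | yes x≗0 = inj₁ x≗0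
  ... | no ¬x≗0 = inj₂ (¬∀⟶∃¬ n _ (λ j → x j ℤ.≟ 0ℤ) ¬x≗0)

unitVector : ∀ {n} → Vect (suc n)
unitVector zero    = 1ℤ
unitVector (suc _) = 0ℤ

lc-unitVector : ∀ {m n} (b : Fin (suc m) → Vect n) j → lc unitVector b j ≡ b zero j
lc-unitVector {m} b j = begin
  1ℤ * b zero j + sumℤ m (λ i → 0ℤ * b (suc i) j) ≡⟨ cong₂ _+_ (ℤP.*-identityˡ (b zero j)) (sum-zero m λ i → ℤP.*-zeroˡ (b (suc i) j)) ⟩
  b zero j + 0ℤ                                   ≡⟨ ℤP.+-identityʳ (b zero j) ⟩
  b zero j                                        ∎

independent⇒nonzero : ∀ {m n} {b : Fin (suc m) → Vect n} → Independent b → ∃ λ j → b zero j ≢ 0ℤ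
independent⇒nonzero {b = b} ind with vanishing? (b zero)
... | inj₂ nz  = nz
... | inj₁ b≗0 with () ← ind unitVector (λ j → trans (lc-unitVector b j) (b≗0 j)) zero

-- A row operation without division: each row is first scaled by the pivot entry `h j`. This loses
-- nothing over ℚ if `h j` is nonzero, and nothing locally at p if `h j` is prime to p; both uses
-- occur.
eliminate : ∀ {m n} → Vect n → Fin n → (Fin m → Vect n) → Fin m → Vect n
eliminate h j G i k = h j * G i k + (- G i j) * h k

eliminate-pivot : ∀ {m n} (h : Vect n) j (G : Fin m → Vect n) i → eliminate h j G i j ≡ 0ℤ
eliminate-pivot h j G i = solve 2 (λ a b → a :* b :+ (:- b) :* a := con 0ℤ) refl (h j) (G i j)

lc-eliminate : ∀ {m n} (c : Vect m) (h : Vect n) j (G : Fin m → Vect n) k →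
  lc c (eliminate h j G) k ≡ h j * lc c G k - lc c G j * h k
lc-eliminate {m} c h j G k = begin
  sumℤ m (λ i → c i * (h j * G i k + (- G i j) * h k))
    ≡⟨ sum-cong m (λ i → solve 5 (λ c a g g' h → c :* (a :* g :+ (:- g') :* h) := a :* (c :* g) :+ (:- h) :* (c :* g')) refl (c i) (h j) (G i k) (G i j) (h k)) ⟩
  sumℤ m (λ i → h j * (c i * G i k) + (- h k) * (c i * G i j))
    ≡⟨ sum-+ m _ _ ⟩
  sumℤ m (λ i → h j * (c i * G i k)) + sumℤ m (λ i → (- h k) * (c i * G i j))
    ≡⟨ cong₂ _+_ (sum-* m (h j) _) (sum-* m (- h k) _) ⟩
  h j * lc c G k + (- h k) * lc c G j
    ≡⟨ solve 4 (λ a b c d → a :* b :+ (:- c) :* d := a :* b :- d :* c) refl (h j) (lc c G k) (h k) (lc c G j) ⟩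
  h j * lc c G k - lc c G j * h k ∎

-- Gaussian elimination: a nonzero first vector clears one column, and the induction runs over the
-- remaining vectors and columns.
dependent : ∀ {m n} → n < m → (b : Fin m → Vect n) →
  ∃ λ c → (∀ j → lc c b j ≡ 0ℤ) × ∃ λ i → c i ≢ 0ℤ
dependent {suc m} {n} n<m b with vanishing? (b zero)
... | inj₁ b≗0 = unitVector , (λ j → trans (lc-unitVector b j) (b≗0 j)) , zero , λ ()
dependent {suc m} {suc n} n<m b | inj₂ (j , bj≢0)
  with c , c-rel , i , ci≢0 ← dependent (ℕP.≤-pred n<m) (λ i → eliminate (b zero) j (b ∘ suc) i ∘ punchIn j)
  = d , d-rel , suc i , ci≢0 ∘ *-cancel-zero (b zero j) bj≢0
  where
  d : Vect (suc m)
  -- The coefficients are read off from `lc-eliminate`.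
  d = (- lc c (b ∘ suc) j) ∷ (λ i → b zero j * c i)

  -- The induction hypothesis omits column j, where the eliminated rows are zero anyway.
  elim-rel : ∀ k → lc c (eliminate (b zero) j (b ∘ suc)) k ≡ 0ℤ
  elim-rel k with j Fin.≟ k
  ... | yes refl = sum-zero m λ i → trans (cong (c i *_) (eliminate-pivot (b zero) j (b ∘ suc) i)) (ℤP.*-zeroʳ (c i))
  ... | no j≢k   = subst (λ k → lc c (eliminate (b zero) j (b ∘ suc)) k ≡ 0ℤ) (punchIn-punchOut j≢k) (c-rel (punchOut j≢k))

  d-rel : ∀ k → lc d b k ≡ 0ℤ
  d-rel k = begin
    - lc c (b ∘ suc) j * b zero k + lc (λ i → b zero j * c i) (b ∘ suc) k
      ≡⟨ cong (_+_ (- lc c (b ∘ suc) j * b zero k)) (lc-* (b zero j) c (b ∘ suc) k) ⟩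
    - lc c (b ∘ suc) j * b zero k + b zero j * lc c (b ∘ suc) k
      ≡⟨ solve 4 (λ a b c d → (:- a) :* b :+ c :* d := c :* d :- a :* b) refl (lc c (b ∘ suc) j) (b zero k) (b zero j) (lc c (b ∘ suc) k) ⟩
    b zero j * lc c (b ∘ suc) k - lc c (b ∘ suc) j * b zero k
      ≡⟨ lc-eliminate c (b zero) j (b ∘ suc) k ⟨
    lc c (eliminate (b zero) j (b ∘ suc)) k
      ≡⟨ elim-rel k ⟩
    0ℤ ∎

independent-tail : ∀ {m n} {b : Fin (suc m) → Vect n} → Independent b → Independent (b ∘ suc)
independent-tail {b = b} ind c c-rel i = ind (0ℤ ∷ c)
  (λ j → cong₂ _+_ (ℤP.*-zeroˡ (b zero j)) (c-rel j)) (suc i)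

-- Arithmetic modulo powers of a prime

module LocalArithmetic {p : ℕ} (p-prime : Prime p) where

  P : ℤ
  P = + p

  pow : ℕ → ℤ
  pow t = + (p ^ t)

  -- An integer that is invertible after localising at p, not a unit of ℤ.
  Unit : ℤ → Set
  Unit u = ¬ (P ∣ℤ u)

  pow-suc : ∀ t → pow (suc t) ≡ P * pow t
  pow-suc t = ℤP.pos-* p (p ^ t)

  pow-+ : ∀ t t' → pow (t ℕ.+ t') ≡ pow t * pow t'
  pow-+ t t' = trans (cong +_ (ℕP.^-distribˡ-+-* p t t')) (ℤP.pos-* (p ^ t) (p ^ t'))

  pow-∣-pow : ∀ {m n} → m ℕ.≤ n → pow m ∣ℤ pow n
  pow-∣-pow {m} m≤n with o , refl ← ℕP.m≤n⇒∃[o]m+o≡n m≤n =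
    divides (pow o) (trans (pow-+ m o) (ℤP.*-comm (pow m) (pow o)))

  pow≢0 : ∀ t → pow t ≢ 0ℤ
  pow≢0 t eq = ℕ.≢-nonZero⁻¹ (p ^ t) {{ℕP.m^n≢0 p t {{prime⇒nonZero p-prime}}}} (ℤP.+-injective eq)

  P≢0 : P ≢ 0ℤ
  P≢0 P≡0 = pow≢0 1 (trans (pow-suc 0) (cong (_* 1ℤ) P≡0))

  P∣0 : P ∣ℤ 0ℤ
  P∣0 = divides 0ℤ refl

  euclid : ∀ a b → P ∣ℤ (a * b) → P ∣ℤ a ⊎ P ∣ℤ b
  euclid a b d with euclidsLemma ∣ a ∣ ∣ b ∣ p-prime (subst (p ∣_) (ℤP.abs-* a b) (S.∣⇒∣ᵤ d))
  ... | inj₁ p∣a = inj₁ (S.∣ᵤ⇒∣ p∣a)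
  ... | inj₂ p∣b = inj₂ (S.∣ᵤ⇒∣ p∣b)

  unit-* : ∀ {a b} → Unit a → Unit b → Unit (a * b)
  unit-* {a} {b} ua ub = [ ua , ub ]′ ∘ euclid a b

  unit-1 : Unit 1ℤ
  unit-1 d = contradiction (ℕD.∣1⇒≡1 (S.∣⇒∣ᵤ d)) (ℕ.nonTrivial⇒≢1 {{prime⇒nonTrivial p-prime}})

  bézout : ∀ {u} → Unit u → ∃₂ λ α β → α * u + β * P ≡ 1ℤ
  bézout {u} unit-u = fromNat (Coprimality.coprime-Bézout coprime)
    where
    coprime : Coprimality.Coprime p ∣ u ∣
    coprime (d∣p , d∣u) with prime⇒irreducible p-prime d∣p
    ... | inj₁ d≡1 = d≡1
    ... | inj₂ refl = contradiction (S.∣ᵤ⇒∣ d∣u) unit-u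

    -- The sign ε carries the Bézout identity from `∣ u ∣` over to `u`.
    abs-multiple : ∀ u → ∃ λ ε → ε * u ≡ + ∣ u ∣
    abs-multiple (+ n)        = 1ℤ , ℤP.*-identityˡ (+ n)
    abs-multiple (ℤ.-[1+ n ]) = ℤ.-1ℤ , ℤP.-1*i≡-i (ℤ.-[1+ n ])

    cast : ∀ x k y l → 1 ℕ.+ x ℕ.* k ≡ y ℕ.* l → 1ℤ + + x * + k ≡ + y * + l
    cast x k y l eq = trans (sym (cong (_+_ 1ℤ) (ℤP.pos-* x k))) (trans (cong +_ eq) (ℤP.pos-* y l))

    fromNat : Bézout.Identity 1 p ∣ u ∣ → ∃₂ λ α β → α * u + β * P ≡ 1ℤ
    fromNat (Bézout.+- x y eq) with ε , εu ← abs-multiple u = - (+ y) * ε , + x , (begin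
      - (+ y) * ε * u + + x * P            ≡⟨ cong (_+_ (- (+ y) * ε * u)) (cast y ∣ u ∣ x p eq) ⟨
      - (+ y) * ε * u + (1ℤ + + y * + ∣ u ∣) ≡⟨ cong (λ q → - (+ y) * ε * u + (1ℤ + + y * q)) εu ⟨
      - (+ y) * ε * u + (1ℤ + + y * (ε * u)) ≡⟨ solve 3 (λ y e u → (:- y) :* e :* u :+ (con 1ℤ :+ y :* (e :* u)) := con 1ℤ) refl (+ y) ε u ⟩
      1ℤ ∎)
    fromNat (Bézout.-+ x y eq) with ε , εu ← abs-multiple u = + y * ε , - (+ x) , (begin
      + y * ε * u + - (+ x) * P            ≡⟨ cong (_+ (- (+ x) * P)) (trans (ℤP.*-assoc (+ y) ε u) (trans (cong (+ y *_) εu) (sym (cast x p y ∣ u ∣ eq)))) ⟩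
      1ℤ + + x * P + - (+ x) * P           ≡⟨ solve 2 (λ x q → con 1ℤ :+ x :* q :+ (:- x) :* q := con 1ℤ) refl (+ x) P ⟩
      1ℤ ∎)

  -- Multiplying the term β' p^t by 1 = α u + β p gives it one more factor p, and the part
  -- containing u joins the other term.
  bézout-pow : ∀ {u} → Unit u → ∀ t → ∃₂ λ α β → α * u + β * pow t ≡ 1ℤ
  bézout-pow {u} unit-u zero = 0ℤ , 1ℤ , refl
  bézout-pow {u} unit-u (suc t) with α , β , eq ← bézout unit-u | α' , β' , eq' ← bézout-pow unit-u t =
    α' + β' * pow t * α , β' * β , (begin
      (α' + β' * pow t * α) * u + β' * β * pow (suc t)
        ≡⟨ cong (λ q → (α' + β' * pow t * α) * u + β' * β * q) (pow-suc t) ⟩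
      (α' + β' * pow t * α) * u + β' * β * (P * pow t)
        ≡⟨ solve 7 (λ a' b' q a u b p → (a' :+ b' :* q :* a) :* u :+ b' :* b :* (p :* q) := a' :* u :+ b' :* q :* (a :* u :+ b :* p)) refl α' β' (pow t) α u β P ⟩
      α' * u + β' * pow t * (α * u + β * P)
        ≡⟨ cong (λ q → α' * u + β' * pow t * q) eq ⟩
      α' * u + β' * pow t * 1ℤ
        ≡⟨ cong (_+_ (α' * u)) (ℤP.*-identityʳ (β' * pow t)) ⟩
      α' * u + β' * pow t
        ≡⟨ eq' ⟩
      1ℤ ∎)

  cancel-unit : ∀ {u} → Unit u → ∀ t c → pow t ∣ℤ (u * c) → pow t ∣ℤ c
  cancel-unit {u} unit-u t c (divides q eq) with α , β , bz ← bézout-pow unit-u t =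
    divides (α * q + β * c) (begin
      c                             ≡⟨ ℤP.*-identityˡ c ⟨
      1ℤ * c                        ≡⟨ cong (_* c) bz ⟨
      (α * u + β * pow t) * c       ≡⟨ solve 5 (λ a u b p c → (a :* u :+ b :* p) :* c := a :* (u :* c) :+ b :* p :* c) refl α u β (pow t) c ⟩
      α * (u * c) + β * pow t * c   ≡⟨ cong (λ x → α * x + β * pow t * c) eq ⟩
      α * (q * pow t) + β * pow t * c ≡⟨ solve 5 (λ a q p b c → a :* (q :* p) :+ b :* p :* c := (a :* q :+ b :* c) :* p) refl α q (pow t) β c ⟩
      (α * q + β * c) * pow t       ∎)

  n<p^n : ∀ n → n < p ^ n
  n<p^n zero    = ℕ.z<s
  n<p^n (suc n) = ℕP.<-≤-trans (ℕ.s<s (n<p^n n)) (ℕP.≤-trans (doubled (p ^ n) (ℕP.m^n>0 p {{prime⇒nonZero p-prime}} n))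
    (ℕP.*-monoˡ-≤ (p ^ n) (ℕ.nonTrivial⇒n>1 p {{prime⇒nonTrivial p-prime}})))
    where
    doubled : ∀ k → 0 < k → suc k ℕ.≤ 2 ℕ.* k
    doubled k 0<k = ℕP.≤-trans (ℕP.+-monoˡ-≤ k 0<k) (ℕP.+-monoʳ-≤ k (ℕP.≤-reflexive (sym (ℕP.+-identityʳ k))))

  -- A nonzero x is smaller in absolute value than p to the power `∣ x ∣`. This turns congruences
  -- modulo all powers of p into equalities.
  divisible⇒zero : ∀ x → (∀ t → pow t ∣ℤ x) → x ≡ 0ℤ
  divisible⇒zero x div with ∣ x ∣ in eq
  ... | zero  = ℤP.∣i∣≡0⇒i≡0 eq
  ... | suc n = contradiction (n<p^n (suc n)) (ℕP.≤⇒≯ (ℕD.∣⇒≤ (subst (p ^ suc n ∣_) eq (S.∣⇒∣ᵤ (div (suc n))))))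

-- Bases of eigenlattices localised at p

module LocalBases {p : ℕ} (p-prime : Prime p) {v : ℕ} (M : Fin v → Fin v → ℤ) (θ : ℤ) where

  open LocalArithmetic p-prime

  -- A relation over ℤ localised at p is stored with its denominator, a unit,
  -- cleared.
  record Spans {m} (b : Fin m → Vect v) (q : ℤ) (x : Vect v) : Set where
    constructor spanned
    field
      unit         : ℤ
      is-unit      : Unit unit
      coefficients : Vect m
      rest         : Vect v
      relation     : ∀ j → unit * x j ≡ lc coefficients b j + q * rest j

  spans-divisible : ∀ {m} (b : Fin m → Vect v) {q x} → (∀ j → q ∣ℤ x j) → Spans b q x
  spans-divisible b {q} {x} q∣x = spanned 1ℤ unit-1 (λ _ → 0ℤ) (λ j → S._∣_.quotient (q∣x j)) λ j → begin
    1ℤ * x j                                                     ≡⟨ ℤP.*-identityˡ (x j) ⟩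
    x j                                                          ≡⟨ S._∣_.equality (q∣x j) ⟩
    S._∣_.quotient (q∣x j) * q                                   ≡⟨ ℤP.*-comm (S._∣_.quotient (q∣x j)) q ⟩
    q * S._∣_.quotient (q∣x j)                                   ≡⟨ ℤP.+-identityˡ (q * S._∣_.quotient (q∣x j)) ⟨
    0ℤ + q * S._∣_.quotient (q∣x j)                              ≡⟨ cong (_+ (q * S._∣_.quotient (q∣x j))) (lc-zero b (λ _ → refl) j) ⟨
    lc (λ _ → 0ℤ) b j + q * S._∣_.quotient (q∣x j)               ∎

  spans-+* : ∀ {m} {b : Fin m → Vect v} {q} a {x y} → Spans b q x → Spans b q y →
    Spans b q (λ j → a * x j + y j)
  spans-+* {b = b} {q} a {x} {y} (spanned u unit-u c z eq) (spanned u' unit-u' c' z' eq') =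
    spanned (u * u') (unit-* unit-u unit-u') (λ i → a * u' * c i + u * c' i) (λ j → a * u' * z j + u * z' j) λ j → begin
      u * u' * (a * x j + y j)
        ≡⟨ solve 5 (λ u u' a x y → u :* u' :* (a :* x :+ y) := a :* u' :* (u :* x) :+ u :* (u' :* y)) refl u u' a (x j) (y j) ⟩
      a * u' * (u * x j) + u * (u' * y j)
        ≡⟨ cong₂ (λ s t → a * u' * s + u * t) (eq j) (eq' j) ⟩
      a * u' * (lc c b j + q * z j) + u * (lc c' b j + q * z' j)
        ≡⟨ solve 7 (λ k u l l' q z z' → k :* (l :+ q :* z) :+ u :* (l' :+ q :* z') := k :* l :+ u :* l' :+ q :* (k :* z :+ u :* z')) refl (a * u') u (lc c b j) (lc c' b j) q (z j) (z' j) ⟩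
      a * u' * lc c b j + u * lc c' b j + q * (a * u' * z j + u * z' j)
        ≡⟨ cong (_+ (q * (a * u' * z j + u * z' j))) (trans (lc-+ (λ i → a * u' * c i) (λ i → u * c' i) b j) (cong₂ _+_ (lc-* (a * u') c b j) (lc-* u c' b j))) ⟨
      lc (λ i → a * u' * c i + u * c' i) b j + q * (a * u' * z j + u * z' j) ∎

  spans-lc : ∀ {m n} {b : Fin m → Vect v} {q} (c : Vect n) {G : Fin n → Vect v} →
    (∀ i → Spans b q (G i)) → Spans b q (lc c G)
  spans-lc {n = zero}  {b} c spG = spans-divisible b λ _ → divides 0ℤ refl
  spans-lc {n = suc n} c spG = spans-+* (c zero) (spG zero) (spans-lc (c ∘ suc) (spG ∘ suc))

  -- A basis modulo p in echelon form. `triangular` says that the square minor in the pivot columns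
  -- is invertible modulo p, without a determinant. `vanish` keeps a column cleared by elimination
  -- clear in the basis, as the next extension step requires. `spans` is a statement modulo p only;
  -- lifting it needs the whole eigenlattice and is done afterwards.
  record LocalBasis {n} (G : Fin n → Vect v) : Set where
    field
      size       : ℕ
      vec        : Fin size → Vect v
      pivot      : Fin size → Fin v
      eigenvector : ∀ i → Eigen M θ (vec i)
      vanish     : ∀ j → (∀ i → G i j ≡ 0ℤ) → ∀ i → vec i j ≡ 0ℤ
      triangular : ∀ c → (∀ k → P ∣ℤ lc c vec (pivot k)) → ∀ i → P ∣ℤ c i
      spans      : ∀ i → Spans vec P (G i)

  open LocalBasis

  -- The old basis is zero in column j, so the new pivot minor is block triangular with the unit
  -- `h j` in the corner. Prescribing h as the first basis vector is what later allows a chosen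
  -- eigenvector to be completed to a basis.
  extend : ∀ {n} {G : Fin n → Vect v} h j → Eigen M θ h → Unit (h j) →
    LocalBasis (eliminate h j G) → LocalBasis (h ∷ G)
  extend {n} {G} h j eh unit-hj B = record
    { size = suc (size B) ; vec = b ; pivot = j ∷ pivot B
    ; eigenvector = λ { zero → eh ; (suc i) → eigenvector B i }
    ; vanish = λ k G≗0 → λ
        { zero → G≗0 zero
        ; (suc i) → vanish B k (λ i → begin
            h j * G i k + (- G i j) * h k ≡⟨ cong₂ (λ s t → h j * s + (- G i j) * t) (G≗0 (suc i)) (G≗0 zero) ⟩
            h j * 0ℤ + (- G i j) * 0ℤ     ≡⟨ cong₂ _+_ (ℤP.*-zeroʳ (h j)) (ℤP.*-zeroʳ (- G i j)) ⟩
            0ℤ                            ∎) i }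
    ; triangular = tri
    ; spans = λ { zero → spans-head ; (suc i) → spans-tail i } }
    where
    b : Fin (suc (size B)) → Vect v
    b = h ∷ vec B

    tri : ∀ c → (∀ k → P ∣ℤ lc c b ((j ∷ pivot B) k)) → ∀ i → P ∣ℤ c i
    tri c div = λ { zero → P∣c₀ ; (suc i) → triangular B (c ∘ suc)
        (λ k → S.∣m+n∣m⇒∣n (div (suc k)) (S.∣m⇒∣m*n (h (pivot B k)) P∣c₀)) i }
      where
      -- In column j only h contributes to the combination.
      P∣c₀ : P ∣ℤ c zero
      P∣c₀ = [ id , (λ d → contradiction d unit-hj) ]′ (euclid (c zero) (h j)
        (subst (P ∣ℤ_) (trans (cong (_+_ (c zero * h j))
            (sum-zero (size B) λ i → trans (cong (c (suc i) *_) (vanish B j (eliminate-pivot h j G) i)) (ℤP.*-zeroʳ (c (suc i)))))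
          (ℤP.+-identityʳ (c zero * h j))) (div zero)))

    spans-head : Spans b P h
    spans-head = spanned 1ℤ unit-1 unitVector (λ _ → 0ℤ) λ k → begin
      1ℤ * h k                      ≡⟨ ℤP.*-identityˡ (h k) ⟩
      h k                           ≡⟨ lc-unitVector b k ⟨
      lc unitVector b k             ≡⟨ ℤP.+-identityʳ (lc unitVector b k) ⟨
      lc unitVector b k + 0ℤ        ≡⟨ cong (_+_ (lc unitVector b k)) (ℤP.*-zeroʳ P) ⟨
      lc unitVector b k + P * 0ℤ    ∎

    spans-tail : ∀ i → Spans b P (G i)
    spans-tail i with spanned u unit-u c z eq ← spans B i =
      spanned (u * h j) (unit-* unit-u unit-hj) (u * G i j ∷ c) z λ k → begin
        u * h j * G i k
          ≡⟨ solve 5 (λ u a g g' h → u :* a :* g := u :* g' :* h :+ u :* (a :* g :+ (:- g') :* h)) refl u (h j) (G i k) (G i j) (h k) ⟩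
        u * G i j * h k + u * (h j * G i k + (- G i j) * h k)
          ≡⟨ cong (_+_ (u * G i j * h k)) (eq k) ⟩
        u * G i j * h k + (lc c (vec B) k + P * z k)
          ≡⟨ ℤP.+-assoc (u * G i j * h k) (lc c (vec B) k) (P * z k) ⟨
        u * G i j * h k + lc c (vec B) k + P * z k ∎

  -- Elimination over the field with p elements, performed on integer vectors: a vector that is zero
  -- modulo p is dropped, any other has a unit entry and supplies a pivot.
  basis : ∀ n (G : Fin n → Vect v) → (∀ i → Eigen M θ (G i)) → LocalBasis G
  basis zero G eG = record
    { size = 0 ; vec = λ () ; pivot = λ () ; eigenvector = λ () ; vanish = λ _ _ ()
    ; triangular = λ _ _ () ; spans = λ () }
  basis (suc n) G eG with all? (λ j → P S.∣? G zero j)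
  ... | yes P∣G₀ = let B = basis n (G ∘ suc) (eG ∘ suc) in record
    { size = size B ; vec = vec B ; pivot = pivot B ; eigenvector = eigenvector B
    ; vanish = λ j G≗0 → vanish B j (G≗0 ∘ suc)
    ; triangular = triangular B
    ; spans = λ { zero → spans-divisible (vec B) P∣G₀ ; (suc i) → spans B i } }
  ... | no ¬P∣G₀ with j , unit ← ¬∀⟶∃¬ v _ (λ j → P S.∣? G zero j) ¬P∣G₀
    -- `G zero ∷ (G ∘ suc)` agrees with `G` only pointwise, hence the rebuilt record.
    = let B = extend (G zero) j (eG zero) unit
                (basis n (eliminate (G zero) j (G ∘ suc)) λ i → eigen-lin M (G zero j) (- G (suc i) j) (eG (suc i)) (eG zero))
      in record
    { size = size B ; vec = vec B ; pivot = pivot B ; eigenvector = eigenvector B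
    ; vanish = λ j G≗0 → vanish B j (λ { zero → G≗0 zero ; (suc i) → G≗0 (suc i) })
    ; triangular = triangular B
    ; spans = λ { zero → spans B zero ; (suc i) → spans B (suc i) } }

  module _ {n} {G : Fin n → Vect v} (B : LocalBasis G)
           (spans-eigen : ∀ x → Eigen M θ x → Spans (vec B) P x) where

    private b = vec B

    -- Only congruences modulo a power of p are needed, so iterating spans-eigen
    -- takes the place of Nakayama's lemma.
    spans-pow : ∀ t x → Eigen M θ x → ∃ λ u → Unit u × ∃₂ λ (c : Vect (size B)) (z : Vect v) → Eigen M θ z ×
      ∀ j → u * x j ≡ lc c b j + pow t * z j
    spans-pow zero x ex = 1ℤ , unit-1 , (λ _ → 0ℤ) , x , ex ,
      λ j → sym (trans (cong (_+ (1ℤ * x j)) (lc-zero b (λ _ → refl) j)) (ℤP.+-identityˡ (1ℤ * x j)))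
    spans-pow (suc t) x ex
      with u , unit-u , c , z , ez , eq ← spans-pow t x ex
      with spanned u' unit-u' c' z' eq' ← spans-eigen z ez
      = u * u' , unit-* unit-u unit-u' , (λ i → u' * c i + pow t * c' i) , z' , ez' , λ j → begin
        u * u' * x j
          ≡⟨ solve 3 (λ u u' x → u :* u' :* x := u' :* (u :* x)) refl u u' (x j) ⟩
        u' * (u * x j)
          ≡⟨ cong (u' *_) (eq j) ⟩
        u' * (lc c b j + pow t * z j)
          ≡⟨ solve 4 (λ u' l q z → u' :* (l :+ q :* z) := u' :* l :+ q :* (u' :* z)) refl u' (lc c b j) (pow t) (z j) ⟩
        u' * lc c b j + pow t * (u' * z j)
          ≡⟨ cong (λ s → u' * lc c b j + pow t * s) (eq' j) ⟩
        u' * lc c b j + pow t * (lc c' b j + P * z' j)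
          ≡⟨ solve 6 (λ u l q l' p z → u :* l :+ q :* (l' :+ p :* z) := u :* l :+ q :* l' :+ p :* q :* z) refl u' (lc c b j) (pow t) (lc c' b j) P (z' j) ⟩
        u' * lc c b j + pow t * lc c' b j + P * pow t * z' j
          ≡⟨ cong₂ (λ s q → s + q * z' j) (trans (lc-+ (λ i → u' * c i) (λ i → pow t * c' i) b j) (cong₂ _+_ (lc-* u' c b j) (lc-* (pow t) c' b j))) (pow-suc t) ⟨
        lc (λ i → u' * c i + pow t * c' i) b j + pow (suc t) * z' j ∎
      where
      -- The remainder P z' is a combination of eigenvectors and P cancels, so z' is an eigenvector
      -- and the iteration can continue with it.
      ez' : Eigen M θ z'
      ez' = eigen-cancel M P P≢0
        (eigen-cong M (λ j → trans (cong (_+ ((- 1ℤ) * lc c' b j)) (eq' j)) (solve 2 (λ l q → l :+ q :+ (:- con 1ℤ) :* l := q) refl (lc c' b j) (P * z' j)))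
          (eigen-lin M u' (- 1ℤ) ez (eigen-lc M c' (eigenvector B))))

    -- Once c is divided by p^t, the quotients again combine to a vector divisible by p, and
    -- `triangular` yields one more factor.
    pow-∣-coefficients : ∀ t c → (∀ j → pow t ∣ℤ lc c b j) → ∀ i → pow t ∣ℤ c i
    pow-∣-coefficients zero c div i = divides (c i) (sym (ℤP.*-identityʳ (c i)))
    pow-∣-coefficients (suc t) c div i = raise (triangular B q (λ k → P∣lc (pivot B k)) i)
      where
      pow-t∣c : ∀ i → pow t ∣ℤ c i
      pow-t∣c = pow-∣-coefficients t c λ j →
        S.∣-trans (divides P (pow-suc t)) (div j)

      q : Vect (size B)
      q i = S._∣_.quotient (pow-t∣c i)

      c≡ : ∀ i → c i ≡ pow t * q i
      c≡ i = trans (S._∣_.equality (pow-t∣c i)) (ℤP.*-comm (q i) (pow t))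

      P∣lc : ∀ j → P ∣ℤ lc q b j
      P∣lc j = S.*-cancelˡ-∣ (pow t) {{ℤ.≢-nonZero (pow≢0 t)}}
        (subst (λ d → d ∣ℤ (pow t * lc q b j)) (trans (pow-suc t) (ℤP.*-comm P (pow t)))
          (subst (pow (suc t) ∣ℤ_) (trans (lc-cong b c≡ j) (lc-* (pow t) q b j)) (div j)))

      raise : P ∣ℤ q i → pow (suc t) ∣ℤ c i
      raise P∣q = subst (λ d → d ∣ℤ c i) (trans (ℤP.*-comm (pow t) P) (sym (pow-suc t)))
        (subst (pow t * P ∣ℤ_) (sym (c≡ i)) (S.*-monoʳ-∣ (pow t) P∣q))

    basis-independent : Independent b
    basis-independent c c-rel i = divisible⇒zero (c i) λ t →
      pow-∣-coefficients t c (λ j → divides 0ℤ (c-rel j)) i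

    -- Infinite descent. Modulo p, a unit multiple of x is a combination of the basis; its zero
    -- pivot entries force p to divide the coefficients, hence x. Then x / p satisfies the same
    -- hypotheses.
    vanishing-on-pivots : ∀ x → Eigen M θ x → (∀ k → x (pivot B k) ≡ 0ℤ) → ∀ j → x j ≡ 0ℤ
    vanishing-on-pivots x ex x≗0 j = divisible⇒zero (x j) λ t →
      let x' , _ , _ , eq = divided t in divides (x' j) (trans (eq j) (ℤP.*-comm (pow t) (x' j)))
      where
      divided : ∀ t → ∃ λ x' → Eigen M θ x' × (∀ k → x' (pivot B k) ≡ 0ℤ) × ∀ j → x j ≡ pow t * x' j
      divided zero = x , ex , x≗0 , λ j → sym (ℤP.*-identityˡ (x j))
      divided (suc t)
        with x' , ex' , x'≗0 , eq ← divided t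
        with spanned u unit-u c z eq' ← spans-eigen x' ex'
        = y , eigen-cancel M P P≢0 (eigen-cong M x'≡ ex') ,
          (λ k → *-cancel-zero P P≢0 (trans (sym (x'≡ (pivot B k))) (x'≗0 k))) ,
          λ j → begin
            x j                ≡⟨ eq j ⟩
            pow t * x' j       ≡⟨ cong (pow t *_) (x'≡ j) ⟩
            pow t * (P * y j)  ≡⟨ solve 3 (λ q p y → q :* (p :* y) := p :* q :* y) refl (pow t) P (y j) ⟩
            P * pow t * y j    ≡⟨ cong (_* y j) (pow-suc t) ⟨
            pow (suc t) * y j  ∎
        where
        P∣c : ∀ i → P ∣ℤ c i
        P∣c = triangular B c λ k → S.∣m+n∣n⇒∣m {m = lc c b (pivot B k)}
          (subst (P ∣ℤ_) (trans (sym (trans (cong (u *_) (x'≗0 k)) (ℤP.*-zeroʳ u))) (eq' (pivot B k))) P∣0)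
          (S.∣m⇒∣m*n (z (pivot B k)) S.∣-refl)

        P∣x' : ∀ j → P ∣ℤ x' j
        P∣x' j = [ (λ d → contradiction d unit-u) , id ]′ (euclid u (x' j)
          (subst (P ∣ℤ_) (sym (eq' j)) (S.∣m∣n⇒∣m+n
            (sum-∣ (size B) λ i → S.∣m⇒∣m*n (b i j) (P∣c i))
            (S.∣m⇒∣m*n (z j) S.∣-refl))))

        y : Vect v
        y j = S._∣_.quotient (P∣x' j)

        x'≡ : ∀ j → x' j ≡ P * y j
        x'≡ j = trans (S._∣_.equality (P∣x' j)) (ℤP.*-comm (y j) P)

    -- Restriction to the pivots is injective on eigenvectors, so a dependence between the
    -- restrictions is one between the vectors.
    independent⇒≤size : ∀ {g} (Y : Fin g → Vect v) → (∀ i → Eigen M θ (Y i)) → Independent Y →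
      ¬ (size B < g)
    independent⇒≤size Y eY indY size<g
      with c , c-rel , i , ci≢0 ← dependent size<g (λ i → Y i ∘ pivot B)
      = ci≢0 (indY c (vanishing-on-pivots (lc c Y) (eigen-lc M c eY) c-rel) i)

-- Rational and integral eigenvectors

toℚ-+ : ∀ a b → toℚ (a + b) ≡ toℚ a ℚ.+ toℚ b
toℚ-+ a b = ℚP.toℚᵘ-injective (ℚᵘP.≃-trans (ℚP.toℚᵘ-fromℚᵘ (mkℚᵘ (a + b) 0))
  (ℚᵘP.≃-trans (*≡* (cong (_* 1ℤ) (sym (cong₂ _+_ (ℤP.*-identityʳ a) (ℤP.*-identityʳ b)))))
  (ℚᵘP.≃-sym (ℚᵘP.≃-trans (ℚP.toℚᵘ-homo-+ (toℚ a) (toℚ b))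
    (ℚᵘP.+-cong (ℚP.toℚᵘ-fromℚᵘ (mkℚᵘ a 0)) (ℚP.toℚᵘ-fromℚᵘ (mkℚᵘ b 0)))))))

toℚ-* : ∀ a b → toℚ (a * b) ≡ toℚ a ℚ.* toℚ b
toℚ-* a b = ℚP.toℚᵘ-injective (ℚᵘP.≃-trans (ℚP.toℚᵘ-fromℚᵘ (mkℚᵘ (a * b) 0))
  (ℚᵘP.≃-sym (ℚᵘP.≃-trans (ℚP.toℚᵘ-homo-* (toℚ a) (toℚ b))
    (ℚᵘP.*-cong (ℚP.toℚᵘ-fromℚᵘ (mkℚᵘ a 0)) (ℚP.toℚᵘ-fromℚᵘ (mkℚᵘ b 0))))))

toℚ-injective : ∀ {a b} → toℚ a ≡ toℚ b → a ≡ b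
toℚ-injective {a} {b} eq with *≡* eq' ← ℚP.fromℚᵘ-injective {mkℚᵘ a 0} {mkℚᵘ b 0} eq =
  trans (sym (ℤP.*-identityʳ a)) (trans eq' (ℤP.*-identityʳ b))

↧*≡↥ : ∀ x → toℚ (ℚ.↧ x) ℚ.* x ≡ toℚ (ℚ.↥ x)
↧*≡↥ x@(mkℚ n d-1 _) = ℚP.toℚᵘ-injective (ℚᵘP.≃-trans (ℚP.toℚᵘ-homo-* (toℚ (ℚ.↧ x)) x)
  (ℚᵘP.≃-trans (ℚᵘP.*-congʳ {ℚ.toℚᵘ x} (ℚP.toℚᵘ-fromℚᵘ (mkℚᵘ (ℚ.↧ x) 0)))
  (ℚᵘP.≃-trans (*≡* (solve 2 (λ d n → d :* n :* con 1ℤ := n :* (con 1ℤ :* d)) refl (+ suc d-1) n))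
    (ℚᵘP.≃-sym (ℚP.toℚᵘ-fromℚᵘ (mkℚᵘ n 0))))))

toℚ-cancel-zero : ∀ d x → d ≢ 0ℤ → toℚ d ℚ.* x ≡ 0ℚ → x ≡ 0ℚ
toℚ-cancel-zero d x d≢0 dx≡0 = ℚP.↥p≡0⇒p≡0 x (*-cancel-zero d d≢0 (toℚ-injective (begin
  toℚ (d * ℚ.↥ x)                     ≡⟨ toℚ-* d (ℚ.↥ x) ⟩
  toℚ d ℚ.* toℚ (ℚ.↥ x)               ≡⟨ cong (toℚ d ℚ.*_) (↧*≡↥ x) ⟨
  toℚ d ℚ.* (toℚ (ℚ.↧ x) ℚ.* x)       ≡⟨ ℚP.*-assoc (toℚ d) (toℚ (ℚ.↧ x)) x ⟨
  toℚ d ℚ.* toℚ (ℚ.↧ x) ℚ.* x         ≡⟨ cong (ℚ._* x) (ℚP.*-comm (toℚ d) (toℚ (ℚ.↧ x))) ⟩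
  toℚ (ℚ.↧ x) ℚ.* toℚ d ℚ.* x         ≡⟨ ℚP.*-assoc (toℚ (ℚ.↧ x)) (toℚ d) x ⟩
  toℚ (ℚ.↧ x) ℚ.* (toℚ d ℚ.* x)       ≡⟨ cong (toℚ (ℚ.↧ x) ℚ.*_) dx≡0 ⟩
  toℚ (ℚ.↧ x) ℚ.* 0ℚ                  ≡⟨ ℚP.*-zeroʳ (toℚ (ℚ.↧ x)) ⟩
  0ℚ                                  ∎)))

commonDenominator : ∀ n (x : Fin n → ℚ) →
  ∃ λ d → d ≢ 0ℤ × ∃ λ (X : Vect n) → ∀ j → toℚ d ℚ.* x j ≡ toℚ (X j)
commonDenominator zero x = 1ℤ , (λ ()) , (λ ()) , λ ()
commonDenominator (suc n) x with d , d≢0 , X , eq ← commonDenominator n (x ∘ suc) =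
  d₀ * d , d₀d≢0 , (d * ℚ.↥ x zero ∷ λ j → d₀ * X j) , λ
    { zero → begin
        toℚ (d₀ * d) ℚ.* x zero         ≡⟨ cong (λ q → toℚ q ℚ.* x zero) (ℤP.*-comm d₀ d) ⟩
        toℚ (d * d₀) ℚ.* x zero         ≡⟨ split d d₀ (x zero) (↧*≡↥ (x zero)) ⟩
        toℚ (d * ℚ.↥ x zero)            ∎
    ; (suc j) → split d₀ d (x (suc j)) {X j} (eq j) }
  where
  d₀ : ℤ
  d₀ = ℚ.↧ x zero

  d₀d≢0 : d₀ * d ≢ 0ℤ
  d₀d≢0 = d≢0 ∘ *-cancel-zero d₀ (λ ())

  split : ∀ a b y {z} → toℚ b ℚ.* y ≡ toℚ z → toℚ (a * b) ℚ.* y ≡ toℚ (a * z)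
  split a b y {z} by≡z = begin
    toℚ (a * b) ℚ.* y           ≡⟨ cong (ℚ._* y) (toℚ-* a b) ⟩
    toℚ a ℚ.* toℚ b ℚ.* y       ≡⟨ ℚP.*-assoc (toℚ a) (toℚ b) y ⟩
    toℚ a ℚ.* (toℚ b ℚ.* y)     ≡⟨ cong (toℚ a ℚ.*_) by≡z ⟩
    toℚ a ℚ.* toℚ z             ≡⟨ toℚ-* a z ⟨
    toℚ (a * z)                 ∎

sumℚ-cong : ∀ n {f g : Fin n → ℚ} → (∀ i → f i ≡ g i) → sumℚ n f ≡ sumℚ n g
sumℚ-cong zero    f≗g = refl
sumℚ-cong (suc n) f≗g = cong₂ ℚ._+_ (f≗g zero) (sumℚ-cong n (f≗g ∘ suc))

sumℚ-* : ∀ n c (f : Fin n → ℚ) → sumℚ n (λ i → c ℚ.* f i) ≡ c ℚ.* sumℚ n f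
sumℚ-* zero    c f = sym (ℚP.*-zeroʳ c)
sumℚ-* (suc n) c f = trans (cong (c ℚ.* f zero ℚ.+_) (sumℚ-* n c (f ∘ suc)))
  (sym (ℚP.*-distribˡ-+ c (f zero) (sumℚ n (f ∘ suc))))

toℚ-sum-* : ∀ n (f g : Vect n) → toℚ (sumℤ n (λ i → f i * g i)) ≡ sumℚ n (λ i → toℚ (f i) ℚ.* toℚ (g i))
toℚ-sum-* zero    f g = refl
toℚ-sum-* (suc n) f g = trans (toℚ-+ (f zero * g zero) (sumℤ n (λ i → f (suc i) * g (suc i))))
  (cong₂ ℚ._+_ (toℚ-* (f zero) (g zero)) (toℚ-sum-* n (f ∘ suc) (g ∘ suc)))

private
  *-swap : ∀ x y z → x ℚ.* (y ℚ.* z) ≡ y ℚ.* (x ℚ.* z)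
  *-swap x y z = trans (sym (ℚP.*-assoc x y z)) (trans (cong (ℚ._* z) (ℚP.*-comm x y)) (ℚP.*-assoc y x z))

module _ {v : ℕ} (M : Fin v → Fin v → ℤ) (θ : ℤ) where

  eigen⇒InEigenspace : ∀ {x : Vect v} → Eigen M θ x → InEigenspace M θ (toℚ ∘ x)
  eigen⇒InEigenspace {x} ex i = begin
    actℚ M (toℚ ∘ x) i  ≡⟨ toℚ-sum-* v (M i) x ⟨
    toℚ (actℤ M x i)    ≡⟨ cong toℚ (act-eigen ex i) ⟩
    toℚ (θ * x i)       ≡⟨ toℚ-* θ (x i) ⟩
    toℚ θ ℚ.* toℚ (x i) ∎

  InEigenspace⇒eigen : ∀ {x d} {X : Vect v} → (∀ j → toℚ d ℚ.* x j ≡ toℚ (X j)) →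
    InEigenspace M θ x → Eigen M θ X
  InEigenspace⇒eigen {x} {d} {X} dx≡X ex = eigen λ i → toℚ-injective (begin
    toℚ (actℤ M X i)                                ≡⟨ toℚ-sum-* v (M i) X ⟩
    sumℚ v (λ j → toℚ (M i j) ℚ.* toℚ (X j))        ≡⟨ sumℚ-cong v (λ j → trans (*-swap (toℚ d) (toℚ (M i j)) (x j)) (cong (toℚ (M i j) ℚ.*_) (dx≡X j))) ⟨
    sumℚ v (λ j → toℚ d ℚ.* (toℚ (M i j) ℚ.* x j))  ≡⟨ sumℚ-* v (toℚ d) (λ j → toℚ (M i j) ℚ.* x j) ⟩
    toℚ d ℚ.* actℚ M x i                            ≡⟨ cong (toℚ d ℚ.*_) (ex i) ⟩
    toℚ d ℚ.* (toℚ θ ℚ.* x i)                       ≡⟨ *-swap (toℚ d) (toℚ θ) (x i) ⟩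
    toℚ θ ℚ.* (toℚ d ℚ.* x i)                       ≡⟨ cong (toℚ θ ℚ.*_) (dx≡X i) ⟩
    toℚ θ ℚ.* toℚ (X i)                             ≡⟨ toℚ-* θ (X i) ⟨
    toℚ (θ * X i)                                   ∎)

  -- Each rational eigenvector may be scaled by its own denominator; a relation between the results
  -- is one between the originals with rescaled coefficients.
  integralEigenvectors : ∀ {g} → EigenMult M θ g →
    ∃ λ (Y : Fin g → Vect v) → (∀ i → Eigen M θ (Y i)) × Independent Y
  integralEigenvectors {g} ((b , eb , ind) , _) = Y , (λ i → InEigenspace⇒eigen {d = d i} (dY i) (eb i)) , indY
    where
    d : Vect g
    d i = proj₁ (commonDenominator v (b i))

    d≢0 : ∀ i → d i ≢ 0ℤ
    d≢0 i = proj₁ (proj₂ (commonDenominator v (b i)))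

    Y : Fin g → Vect v
    Y i = proj₁ (proj₂ (proj₂ (commonDenominator v (b i))))

    dY : ∀ i j → toℚ (d i) ℚ.* b i j ≡ toℚ (Y i j)
    dY i = proj₂ (proj₂ (proj₂ (commonDenominator v (b i))))

    indY : Independent Y
    indY c c-rel i = *-cancel-zero (d i) (d≢0 i) (toℚ-injective (trans (cong toℚ (ℤP.*-comm (d i) (c i)))
      (ind (λ i → toℚ (c i * d i)) (λ j → begin
        sumℚ g (λ i → toℚ (c i * d i) ℚ.* b i j)
          ≡⟨ sumℚ-cong g (λ i → trans (cong (ℚ._* b i j) (toℚ-* (c i) (d i)))
               (trans (ℚP.*-assoc (toℚ (c i)) (toℚ (d i)) (b i j)) (cong (toℚ (c i) ℚ.*_) (dY i j)))) ⟩
        sumℚ g (λ i → toℚ (c i) ℚ.* toℚ (Y i j)) ≡⟨ toℚ-sum-* g c (λ i → Y i j) ⟨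
        toℚ (lc c Y j)                           ≡⟨ cong toℚ (c-rel j) ⟩
        0ℚ                                       ∎) i)))

  independent⇒LinIndep : ∀ {m} {b : Fin m → Vect v} → Independent b → LinIndep (λ i → toℚ ∘ b i)
  independent⇒LinIndep {m} {b} ind c c-rel i with d , d≢0 , C , eq ← commonDenominator m c =
    toℚ-cancel-zero d (c i) d≢0 (trans (eq i) (cong toℚ (ind C C-rel i)))
    where
    C-rel : ∀ j → lc C b j ≡ 0ℤ
    C-rel j = toℚ-injective (begin
      toℚ (lc C b j)                                      ≡⟨ toℚ-sum-* m C (λ i → b i j) ⟩
      sumℚ m (λ i → toℚ (C i) ℚ.* toℚ (b i j))            ≡⟨ sumℚ-cong m (λ i → trans (sym (ℚP.*-assoc (toℚ d) (c i) (toℚ (b i j)))) (cong (ℚ._* toℚ (b i j)) (eq i))) ⟨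
      sumℚ m (λ i → toℚ d ℚ.* (c i ℚ.* toℚ (b i j)))      ≡⟨ sumℚ-* m (toℚ d) (λ i → c i ℚ.* toℚ (b i j)) ⟩
      toℚ d ℚ.* sumℚ m (λ i → c i ℚ.* toℚ (b i j))        ≡⟨ cong (toℚ d ℚ.*_) (c-rel j) ⟩
      toℚ d ℚ.* 0ℚ                                        ≡⟨ ℚP.*-zeroʳ (toℚ d) ⟩
      0ℚ                                                  ∎)

  -- Maximality in `EigenMult` concerns families of exactly g + 1 vectors, so a longer family is
  -- first shortened from the front.
  independent⇒≤multiplicity : ∀ {g m} → EigenMult M θ g → (b : Fin m → Vect v) →
    (∀ i → Eigen M θ (b i)) → Independent b → ¬ (g < m)
  independent⇒≤multiplicity {g} (_ , maximal) b eb ind g<m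
    with d , eq ← ℕP.m≤n⇒∃[o]m+o≡n g<m
    with refl ← trans (ℕP.+-comm d (suc g)) eq =
    tooMany d b eb ind
    where
    tooMany : ∀ d (b : Fin (d ℕ.+ suc g) → Vect v) → (∀ i → Eigen M θ (b i)) → ¬ Independent b
    tooMany zero    b eb ind = maximal (λ i → toℚ ∘ b i) (eigen⇒InEigenspace ∘ eb) (independent⇒LinIndep {b = b} ind)
    tooMany (suc d) b eb ind = tooMany d (b ∘ suc) (eb ∘ suc) (independent-tail {b = b} ind)

-- The Laplacian of a strongly regular graph

laplacian-act : ∀ {v} (Γ : Graph v) k x i →
  actℤ (laplacian Γ k) x i ≡ + k * x i - actℤ (adjMat Γ) x i
laplacian-act {v} Γ k x i = begin
  sumℤ v (λ j → laplacian Γ k i j * x j)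
    ≡⟨ sum-cong v (λ j → trans (cong (λ q → (q - adjMat Γ i j) * x j) (diagonal (does (i Fin.≟ j))))
         (solve 4 (λ k d a x → (k :* d :- a) :* x := k :* (x :* d) :+ (:- con 1ℤ) :* (a :* x)) refl (+ k) (δ i j) (adjMat Γ i j) (x j))) ⟩
  sumℤ v (λ j → + k * (x j * δ i j) + (- 1ℤ) * (adjMat Γ i j * x j))
    ≡⟨ sum-+ v _ _ ⟩
  sumℤ v (λ j → + k * (x j * δ i j)) + sumℤ v (λ j → (- 1ℤ) * (adjMat Γ i j * x j))
    ≡⟨ cong₂ _+_ (sum-* v (+ k) _) (sum-* v (- 1ℤ) _) ⟩
  + k * sumℤ v (λ j → x j * δ i j) + (- 1ℤ) * actℤ (adjMat Γ) x i
    ≡⟨ cong₂ (λ s t → + k * s + t) (trans (sum-cong v λ j → cong (x j *_) (δ-comm i j)) (sum-δ x i)) (ℤP.-1*i≡-i (actℤ (adjMat Γ) x i)) ⟩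
  + k * x i - actℤ (adjMat Γ) x i ∎
  where
  diagonal : ∀ d → (if d then + k else 0ℤ) ≡ + k * (if d then 1ℤ else 0ℤ)
  diagonal true  = sym (ℤP.*-identityʳ (+ k))
  diagonal false = sym (ℤP.*-zeroʳ (+ k))

+-sumℕ : ∀ n (f : Fin n → ℕ) → + sumℕ n f ≡ sumℤ n (λ i → + f i)
+-sumℕ zero    f = refl
+-sumℕ (suc n) f = cong (_+_ (+ f zero)) (+-sumℕ n (f ∘ suc))

module StronglyRegular {v k λ' μ : ℕ} (Γ : Graph v) (srg : IsSRG Γ k λ' μ) where

  A L : Fin v → Fin v → ℤ
  A = adjMat Γ
  L = laplacian Γ k

  row-sum : ∀ i → sumℤ v (A i) ≡ + k
  row-sum i = trans (sym (+-sumℕ v λ j → b2n (adj Γ i j))) (cong +_ (proj₁ srg i))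

  common-sum : ∀ i j → + common Γ i j ≡ sumℤ v (λ l → A i l * A j l)
  common-sum i j = trans (+-sumℕ v λ l → b2n (adj Γ i l ∧ adj Γ j l)) (sum-cong v λ l → b2n-∧ (adj Γ i l) (adj Γ j l))
    where
    b2n-∧ : ∀ x y → + b2n (x ∧ y) ≡ + b2n x * + b2n y
    b2n-∧ true  true  = refl
    b2n-∧ true  false = refl
    b2n-∧ false true  = refl
    b2n-∧ false false = refl

  -- The square of A counts walks of length two, so off the diagonal its entries are numbers of
  -- common neighbours. The three cases are the three clauses of `IsSRG`.
  adjacency-square : ∀ i j → sumℤ v (λ l → A i l * A j l) ≡
    (+ k - + μ) * δ i j + (+ λ' - + μ) * A i j + + μ
  adjacency-square i j with i Fin.≟ j
  ... | yes refl rewrite irrefl Γ i = begin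
    sumℤ v (λ l → A i l * A i l) ≡⟨ sum-cong v (λ l → idem (adj Γ i l)) ⟩
    sumℤ v (A i)                 ≡⟨ row-sum i ⟩
    + k                          ≡⟨ solve 3 (λ k l m → k := (k :- m) :* con 1ℤ :+ (l :- m) :* con 0ℤ :+ m) refl (+ k) (+ λ') (+ μ) ⟩
    (+ k - + μ) * 1ℤ + (+ λ' - + μ) * 0ℤ + + μ ∎
    where
    idem : ∀ x → + b2n x * + b2n x ≡ + b2n x
    idem true  = refl
    idem false = refl
  ... | no i≢j with adj Γ i j in eq
  ... | true  = trans (sym (common-sum i j)) (trans (cong +_ (proj₁ (proj₂ srg) i j eq))
    (solve 3 (λ k l m → l := (k :- m) :* con 0ℤ :+ (l :- m) :* con 1ℤ :+ m) refl (+ k) (+ λ') (+ μ)))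
  ... | false = trans (sym (common-sum i j)) (trans (cong +_ (proj₂ (proj₂ srg) i j i≢j eq))
    (solve 3 (λ k l m → m := (k :- m) :* con 0ℤ :+ (l :- m) :* con 0ℤ :+ m) refl (+ k) (+ λ') (+ μ)))

  A-sym : ∀ i j → A i j ≡ A j i
  A-sym i j = cong (+_ ∘ b2n) (adj-sym Γ i j)

  act-adjacency-square : ∀ x i → actℤ A (actℤ A x) i ≡
    (+ k - + μ) * x i + (+ λ' - + μ) * actℤ A x i + + μ * sumℤ v x
  act-adjacency-square x i = begin
    sumℤ v (λ j → A i j * sumℤ v (λ l → A j l * x l))
      ≡⟨ sum-cong v (λ j → sum-* v (A i j) (λ l → A j l * x l)) ⟨
    sumℤ v (λ j → sumℤ v (λ l → A i j * (A j l * x l)))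
      ≡⟨ sum-swap v v (λ j l → A i j * (A j l * x l)) ⟩
    sumℤ v (λ l → sumℤ v (λ j → A i j * (A j l * x l)))
      ≡⟨ sum-cong v (λ l → trans (sum-cong v λ j → trans (cong (λ q → A i j * (q * x l)) (A-sym j l))
           (solve 3 (λ a b x → a :* (b :* x) := x :* (a :* b)) refl (A i j) (A l j) (x l)))
           (sum-* v (x l) (λ j → A i j * A l j))) ⟩
    sumℤ v (λ l → x l * sumℤ v (λ j → A i j * A l j))
      ≡⟨ sum-cong v (λ l → trans (cong (x l *_) (adjacency-square i l))
           (solve 6 (λ x a d b c m → x :* (a :* d :+ b :* c :+ m) := (a :* (x :* d) :+ b :* (c :* x)) :+ m :* x) refl
             (x l) (+ k - + μ) (δ i l) (+ λ' - + μ) (A i l) (+ μ))) ⟩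
    sumℤ v (λ l → ((+ k - + μ) * (x l * δ i l) + (+ λ' - + μ) * (A i l * x l)) + + μ * x l)
      ≡⟨ trans (sum-+ v _ _) (cong₂ _+_ (trans (sum-+ v _ _) (cong₂ _+_ (sum-* v (+ k - + μ) (λ l → x l * δ i l)) (sum-* v (+ λ' - + μ) (λ l → A i l * x l)))) (sum-* v (+ μ) x)) ⟩
    (+ k - + μ) * sumℤ v (λ l → x l * δ i l) + (+ λ' - + μ) * actℤ A x i + + μ * sumℤ v x
      ≡⟨ cong (λ q → (+ k - + μ) * q + (+ λ' - + μ) * actℤ A x i + + μ * sumℤ v x)
           (trans (sum-cong v λ j → cong (x j *_) (δ-comm i j)) (sum-δ x i)) ⟩
    (+ k - + μ) * x i + (+ λ' - + μ) * actℤ A x i + + μ * sumℤ v x ∎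

  laplacian-ones : ∀ i → actℤ L (λ _ → 1ℤ) i ≡ 0ℤ
  laplacian-ones i = begin
    actℤ L (λ _ → 1ℤ) i                        ≡⟨ laplacian-act Γ k (λ _ → 1ℤ) i ⟩
    + k * 1ℤ - sumℤ v (λ j → A i j * 1ℤ)       ≡⟨ cong₂ _-_ (ℤP.*-identityʳ (+ k)) (trans (sum-cong v λ j → ℤP.*-identityʳ (A i j)) (row-sum i)) ⟩
    + k - + k                                  ≡⟨ ℤP.+-inverseʳ (+ k) ⟩
    0ℤ                                         ∎

  laplacian-sum : ∀ x → sumℤ v (actℤ L x) ≡ 0ℤ
  laplacian-sum x = begin
    sumℤ v (actℤ L x)
      ≡⟨ sum-cong v (λ i → trans (laplacian-act Γ k x i) (cong (_+_ (+ k * x i)) (sym (ℤP.-1*i≡-i (actℤ A x i))))) ⟩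
    sumℤ v (λ i → + k * x i + (- 1ℤ) * actℤ A x i)
      ≡⟨ trans (sum-+ v _ _) (cong₂ _+_ (sum-* v (+ k) x) (sum-* v (- 1ℤ) (actℤ A x))) ⟩
    + k * sumℤ v x + (- 1ℤ) * sumℤ v (actℤ A x)
      ≡⟨ cong (λ q → + k * sumℤ v x + (- 1ℤ) * q) column-sums ⟩
    + k * sumℤ v x + (- 1ℤ) * (+ k * sumℤ v x)
      ≡⟨ solve 1 (λ q → q :+ (:- con 1ℤ) :* q := con 0ℤ) refl (+ k * sumℤ v x) ⟩
    0ℤ ∎
    where
    column-sums : sumℤ v (actℤ A x) ≡ + k * sumℤ v x
    column-sums = begin
      sumℤ v (λ i → sumℤ v (λ j → A i j * x j)) ≡⟨ sum-swap v v (λ i j → A i j * x j) ⟩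
      sumℤ v (λ j → sumℤ v (λ i → A i j * x j)) ≡⟨ sum-cong v (λ j → trans (sum-cong v λ i → trans (cong (_* x j) (A-sym i j)) (ℤP.*-comm (A j i) (x j)))
                                                     (trans (sum-* v (x j) (A j)) (trans (cong (x j *_) (row-sum j)) (ℤP.*-comm (x j) (+ k))))) ⟩
      sumℤ v (λ j → + k * x j)                  ≡⟨ sum-* v (+ k) x ⟩
      + k * sumℤ v x                            ∎

  -- Sum and product of the roots of the quadratic for L on sum-zero vectors, found by substituting
  -- A = k - L into the formula for the square of A.
  t q : ℤ
  t = + k + + k - + λ' + + μ
  q = (+ k - + λ' + + μ) * + k - + k + + μ

  laplacian-square : ∀ x i → actℤ L (actℤ L x) i ≡ t * actℤ L x i - q * x i + + μ * sumℤ v x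
  laplacian-square x i = begin
    actℤ L (actℤ L x) i
      ≡⟨ laplacian-act Γ k (actℤ L x) i ⟩
    + k * actℤ L x i - actℤ A (actℤ L x) i
      ≡⟨ cong (λ s → + k * actℤ L x i - s) (trans
           (act-cong A (λ j → trans (laplacian-act Γ k x j) (cong (_+_ (+ k * x j)) (sym (ℤP.-1*i≡-i (actℤ A x j))))) i)
           (act-lin A (+ k) (- 1ℤ) x (actℤ A x) i)) ⟩
    + k * actℤ L x i - (+ k * actℤ A x i + (- 1ℤ) * actℤ A (actℤ A x) i)
      ≡⟨ cong₂ (λ l a → + k * l - (+ k * actℤ A x i + (- 1ℤ) * a)) (laplacian-act Γ k x i) (act-adjacency-square x i) ⟩
    + k * (+ k * x i - actℤ A x i) - (+ k * actℤ A x i + (- 1ℤ) * ((+ k - + μ) * x i + (+ λ' - + μ) * actℤ A x i + + μ * sumℤ v x))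
      ≡⟨ solve 6 (λ k l m x a s →
           k :* (k :* x :- a) :- (k :* a :+ (:- con 1ℤ) :* ((k :- m) :* x :+ (l :- m) :* a :+ m :* s))
           := (k :+ k :- l :+ m) :* (k :* x :- a) :- ((k :- l :+ m) :* k :- k :+ m) :* x :+ m :* s) refl
           (+ k) (+ λ') (+ μ) (x i) (actℤ A x i) (sumℤ v x) ⟩
    t * (+ k * x i - actℤ A x i) - q * x i + + μ * sumℤ v x
      ≡⟨ cong (λ l → t * l - q * x i + + μ * sumℤ v x) (laplacian-act Γ k x i) ⟨
    t * actℤ L x i - q * x i + + μ * sumℤ v x ∎

  -- For θ nonzero the eigenvector has sum zero, which removes the μJ term from `laplacian-square`.
  eigenvalue-root : ∀ {θ x} → θ ≢ 0ℤ → Eigen L θ x → (∃ λ j → x j ≢ 0ℤ) → θ * θ - t * θ + q ≡ 0ℤ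
  eigenvalue-root {θ} {x} θ≢0 ex (j , xj≢0) = *-cancel-zero (x j) xj≢0 (begin
    x j * (θ * θ - t * θ + q)
      ≡⟨ solve 4 (λ x h t q → x :* (h :* h :- t :* h :+ q) := h :* (h :* x) :- (t :* (h :* x) :- q :* x)) refl (x j) θ t q ⟩
    θ * (θ * x j) - (t * (θ * x j) - q * x j)
      ≡⟨ cong (λ s → s - (t * (θ * x j) - q * x j)) square ⟩
    (t * (θ * x j) - q * x j) - (t * (θ * x j) - q * x j)
      ≡⟨ ℤP.+-inverseʳ (t * (θ * x j) - q * x j) ⟩
    0ℤ ∎)
    where
    square : θ * (θ * x j) ≡ t * (θ * x j) - q * x j
    square = begin
      θ * (θ * x j)                                       ≡⟨ cong (θ *_) (act-eigen ex j) ⟨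
      θ * actℤ L x j                                      ≡⟨ act-* L θ x j ⟨
      actℤ L (λ i → θ * x i) j                            ≡⟨ act-cong L (act-eigen ex) j ⟨
      actℤ L (actℤ L x) j                                 ≡⟨ laplacian-square x j ⟩
      t * actℤ L x j - q * x j + + μ * sumℤ v x           ≡⟨ cong₂ (λ l s → t * l - q * x j + + μ * s) (act-eigen ex j) (eigen⇒sum-zero L laplacian-sum θ≢0 ex) ⟩
      t * (θ * x j) - q * x j + + μ * 0ℤ                  ≡⟨ trans (cong (_+_ (t * (θ * x j) - q * x j)) (ℤP.*-zeroʳ (+ μ))) (ℤP.+-identityʳ (t * (θ * x j) - q * x j)) ⟩
      t * (θ * x j) - q * x j                             ∎

  -- The quadratic relation is evaluated at the all-ones vector, which L kills; the argument of type
  -- `Fin v` provides an entry to look at.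
  q≡μv : Fin v → q ≡ + μ * + v
  q≡μv i = sym (ℤP.i-j≡0⇒i≡j (+ μ * + v) q (begin
    + μ * + v - q
      ≡⟨ solve 3 (λ m v q → m :* v :- q := con 0ℤ :- q :* con 1ℤ :+ m :* (v :* con 1ℤ)) refl (+ μ) (+ v) q ⟩
    0ℤ - q * 1ℤ + + μ * (+ v * 1ℤ)
      ≡⟨ cong₂ (λ l s → l - q * 1ℤ + + μ * s) (trans (cong (t *_) (laplacian-ones i)) (ℤP.*-zeroʳ t)) (sum-const v 1ℤ) ⟨
    t * actℤ L (λ _ → 1ℤ) i - q * 1ℤ + + μ * sumℤ v (λ _ → 1ℤ)
      ≡⟨ laplacian-square (λ _ → 1ℤ) i ⟨
    actℤ L (actℤ L (λ _ → 1ℤ)) i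
      ≡⟨ act-cong L laplacian-ones i ⟩
    actℤ L (λ _ → 0ℤ) i
      ≡⟨ sum-zero v (λ j → ℤP.*-zeroʳ (L i j)) ⟩
    0ℤ ∎))

vieta : ∀ {r s t q : ℤ} → r ≢ s → r * r - t * r + q ≡ 0ℤ → s * s - t * s + q ≡ 0ℤ →
  t ≡ r + s × q ≡ r * s
vieta {r} {s} {t} {q} r≢s root-r root-s = sym sum≡t , (begin
  q                                     ≡⟨ solve 3 (λ r t q → q := (r :* r :- t :* r :+ q) :+ (t :- r) :* r) refl r t q ⟩
  (r * r - t * r + q) + (t - r) * r     ≡⟨ cong₂ (λ e t → e + (t - r) * r) root-r (sym sum≡t) ⟩
  0ℤ + (r + s - r) * r                  ≡⟨ solve 2 (λ r s → con 0ℤ :+ (r :+ s :- r) :* r := r :* s) refl r s ⟩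
  r * s                                 ∎)
  where
  sum≡t : r + s ≡ t
  sum≡t = ℤP.i-j≡0⇒i≡j (r + s) t (*-cancel-zero (r - s) (λ r-s≡0 → r≢s (ℤP.i-j≡0⇒i≡j r s r-s≡0)) (begin
    (r - s) * (r + s - t)
      ≡⟨ solve 4 (λ r s t q → (r :- s) :* (r :+ s :- t) := (r :* r :- t :* r :+ q) :- (s :* s :- t :* s :+ q)) refl r s t q ⟩
    (r * r - t * r + q) - (s * s - t * s + q)
      ≡⟨ cong₂ _-_ root-r root-s ⟩
    0ℤ ∎))

-- The p-part of the cokernel

module _ {v : ℕ} (M : Fin v → Fin v → ℤ) where

  image-lin : ∀ a b {x y : Vect v} → InImage M x → InImage M y → InImage M (λ i → a * x i + b * y i)
  image-lin a b (z , eq) (z' , eq') = (λ j → a * z j + b * z' j) ,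
    λ i → trans (act-lin M a b z z' i) (cong₂ (λ s t → a * s + b * t) (eq i) (eq' i))

  image-lc : ∀ {m} (c : Vect m) {X : Fin m → Vect v} → (∀ i → InImage M (X i)) → InImage M (lc c X)
  image-lc {m} c imX = lc c (proj₁ ∘ imX) ,
    λ i → trans (act-lc M c (proj₁ ∘ imX) i) (sum-cong m λ l → cong (c l *_) (proj₂ (imX l) i))

  image-cong : ∀ {x y : Vect v} → (∀ i → x i ≡ y i) → InImage M x → InImage M y
  image-cong x≗y (z , eq) = z , λ i → trans (eq i) (x≗y i)

-- Sum-zero vectors and the s-eigenlattice

module TwoEigenvalues {v : ℕ} (M : Fin v → Fin v → ℤ) (r s μ : ℤ)
  (image-sum : ∀ x → sumℤ v (actℤ M x) ≡ 0ℤ)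
  (act-ones : ∀ i → actℤ M (λ _ → 1ℤ) i ≡ 0ℤ)
  (act-square : ∀ x i → actℤ M (actℤ M x) i ≡ (r + s) * actℤ M x i - r * s * x i + μ * sumℤ v x)
  (rs≡μv : r * s ≡ μ * + v)
  (s≢0 : s ≢ 0ℤ)
  (o : Fin v)
  where

  s-eigen⇒sum-zero : ∀ {x} → Eigen M s x → sumℤ v x ≡ 0ℤ
  s-eigen⇒sum-zero = eigen⇒sum-zero M image-sum s≢0

  -- On sum-zero vectors the quadratic relation reads M (r + s - M) = rs.
  rs-image : ∀ {x} → sumℤ v x ≡ 0ℤ → InImage M (λ i → r * s * x i)
  rs-image {x} σ≡0 = (λ i → (r + s) * x i + (- 1ℤ) * actℤ M x i) , λ i → begin
    actℤ M (λ i → (r + s) * x i + (- 1ℤ) * actℤ M x i) i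
      ≡⟨ act-lin M (r + s) (- 1ℤ) x (actℤ M x) i ⟩
    (r + s) * actℤ M x i + (- 1ℤ) * actℤ M (actℤ M x) i
      ≡⟨ cong (λ q → (r + s) * actℤ M x i + (- 1ℤ) * q) (trans (act-square x i) (cong (λ σ → (r + s) * actℤ M x i - r * s * x i + μ * σ) σ≡0)) ⟩
    (r + s) * actℤ M x i + (- 1ℤ) * ((r + s) * actℤ M x i - r * s * x i + μ * 0ℤ)
      ≡⟨ solve 3 (λ l q m → l :+ (:- con 1ℤ) :* (l :- q :+ m :* con 0ℤ) := q) refl ((r + s) * actℤ M x i) (r * s * x i) μ ⟩
    r * s * x i ∎

  -- The operator M - r, which on sum-zero vectors is s - r times the projection to the
  -- s-eigenspace. The factor `1ℤ` gives it the shape that `act-lin` and `image-lin` expect.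
  shift : Vect v → Vect v
  shift x i = 1ℤ * actℤ M x i + (- r) * x i

  act-shift : ∀ x i → actℤ M (shift x) i ≡ s * shift x i + μ * sumℤ v x
  act-shift x i = begin
    actℤ M (shift x) i
      ≡⟨ act-lin M 1ℤ (- r) (actℤ M x) x i ⟩
    1ℤ * actℤ M (actℤ M x) i + (- r) * actℤ M x i
      ≡⟨ cong (λ q → 1ℤ * q + (- r) * actℤ M x i) (act-square x i) ⟩
    1ℤ * ((r + s) * actℤ M x i - r * s * x i + μ * sumℤ v x) + (- r) * actℤ M x i
      ≡⟨ solve 5 (λ r s l x m → con 1ℤ :* ((r :+ s) :* l :- r :* s :* x :+ m) :+ (:- r) :* l := s :* (con 1ℤ :* l :+ (:- r) :* x) :+ m) refl r s (actℤ M x i) (x i) (μ * sumℤ v x) ⟩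
    s * shift x i + μ * sumℤ v x ∎

  shift-act : ∀ x i → shift (actℤ M x) i ≡ s * shift x i + μ * sumℤ v x
  shift-act x i = trans (sym (act-lin M 1ℤ (- r) (actℤ M x) x i)) (act-shift x i)

  eigen-shift : ∀ {x} → sumℤ v x ≡ 0ℤ → Eigen M s (shift x)
  eigen-shift {x} σ≡0 = eigen λ i → begin
    actℤ M (shift x) i            ≡⟨ act-shift x i ⟩
    s * shift x i + μ * sumℤ v x  ≡⟨ cong (λ σ → s * shift x i + μ * σ) σ≡0 ⟩
    s * shift x i + μ * 0ℤ        ≡⟨ cong (_+_ (s * shift x i)) (ℤP.*-zeroʳ μ) ⟩
    s * shift x i + 0ℤ            ≡⟨ ℤP.+-identityʳ (s * shift x i) ⟩
    s * shift x i                 ∎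

  shift-eigen : ∀ {x} → Eigen M s x → ∀ i → shift x i ≡ (s - r) * x i
  shift-eigen {x} ex i = trans (cong (λ q → 1ℤ * q + (- r) * x i) (act-eigen ex i))
    (solve 3 (λ r s x → con 1ℤ :* (s :* x) :+ (:- r) :* x := (s :- r) :* x) refl r s (x i))

  shift-cong : ∀ {x y : Vect v} → (∀ i → x i ≡ y i) → ∀ i → shift x i ≡ shift y i
  shift-cong x≗y i = cong₂ (λ a b → 1ℤ * a + (- r) * b) (act-cong M x≗y i) (x≗y i)

  shift-lc : ∀ {m} (c : Vect m) (b : Fin m → Vect v) i → shift (lc c b) i ≡ lc c (shift ∘ b) i
  shift-lc {m} c b i = begin
    1ℤ * actℤ M (lc c b) i + (- r) * lc c b i
      ≡⟨ cong (λ q → 1ℤ * q + (- r) * lc c b i) (act-lc M c b i) ⟩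
    1ℤ * lc c (actℤ M ∘ b) i + (- r) * lc c b i
      ≡⟨ cong₂ _+_ (sum-* m 1ℤ (λ l → c l * actℤ M (b l) i)) (sum-* m (- r) (λ l → c l * b l i)) ⟨
    sumℤ m (λ l → 1ℤ * (c l * actℤ M (b l) i)) + sumℤ m (λ l → (- r) * (c l * b l i))
      ≡⟨ sum-+ m (λ l → 1ℤ * (c l * actℤ M (b l) i)) (λ l → (- r) * (c l * b l i)) ⟨
    sumℤ m (λ l → 1ℤ * (c l * actℤ M (b l) i) + (- r) * (c l * b l i))
      ≡⟨ sum-cong m (λ l → solve 4 (λ c a r b → con 1ℤ :* (c :* a) :+ (:- r) :* (c :* b) := c :* (con 1ℤ :* a :+ (:- r) :* b)) refl (c l) (actℤ M (b l) i) r (b l i)) ⟩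
    lc c (shift ∘ b) i ∎

  sum-δ-row : ∀ l → sumℤ v (δ l) ≡ 1ℤ
  sum-δ-row l = trans (sum-cong v λ j → trans (δ-comm l j) (sym (ℤP.*-identityˡ (δ j l)))) (sum-δ (λ _ → 1ℤ) l)

  difference : Fin v → Vect v
  difference l j = δ l j + (- 1ℤ) * δ o j

  difference-sum : ∀ l → sumℤ v (difference l) ≡ 0ℤ
  difference-sum l = begin
    sumℤ v (difference l)                     ≡⟨ sum-+ v (δ l) (λ j → (- 1ℤ) * δ o j) ⟩
    sumℤ v (δ l) + sumℤ v (λ j → (- 1ℤ) * δ o j) ≡⟨ cong₂ _+_ (sum-δ-row l) (trans (sum-* v (- 1ℤ) (δ o)) (cong (- 1ℤ *_) (sum-δ-row o))) ⟩
    0ℤ                                        ∎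

  lc-difference : ∀ {x} → sumℤ v x ≡ 0ℤ → ∀ j → lc x difference j ≡ x j
  lc-difference {x} σ≡0 j = begin
    sumℤ v (λ l → x l * (δ l j + (- 1ℤ) * δ o j))
      ≡⟨ sum-cong v (λ l → solve 3 (λ x d e → x :* (d :+ (:- con 1ℤ) :* e) := x :* d :+ (:- e) :* x) refl (x l) (δ l j) (δ o j)) ⟩
    sumℤ v (λ l → x l * δ l j + (- δ o j) * x l)
      ≡⟨ trans (sum-+ v (λ l → x l * δ l j) (λ l → (- δ o j) * x l)) (cong₂ _+_ (sum-δ x j) (sum-* v (- δ o j) x)) ⟩
    x j + (- δ o j) * sumℤ v x
      ≡⟨ cong (λ σ → x j + (- δ o j) * σ) σ≡0 ⟩
    x j + (- δ o j) * 0ℤ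
      ≡⟨ trans (cong (_+_ (x j)) (ℤP.*-zeroʳ (- δ o j))) (ℤP.+-identityʳ (x j)) ⟩
    x j ∎

  -- The vectors δ l - δ o generate the sum-zero lattice. Their images under M - r generate a
  -- sublattice containing s - r times the s-eigenlattice, hence all of it locally when s - r is a
  -- unit.
  generator : Fin v → Vect v
  generator l = shift (difference l)

  generator-eigen : ∀ l → Eigen M s (generator l)
  generator-eigen l = eigen-shift (difference-sum l)

  shift-generators : ∀ {x} → sumℤ v x ≡ 0ℤ → ∀ j → shift x j ≡ lc x generator j
  shift-generators {x} σ≡0 j =
    trans (shift-cong (λ i → sym (lc-difference σ≡0 i)) j) (shift-lc x difference j)

  -- v (s - r) times the orthogonal projection of δ o to the s-eigenspace.
  special : Vect v
  special j = + v * shift (δ o) j + r * 1ℤ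

  -- The defect μv that `shift (δ o)` leaves because its argument does not have sum zero equals rs,
  -- exactly what the constant r is missing.
  special-eigen : Eigen M s special
  special-eigen = eigen λ i → begin
    actℤ M special i
      ≡⟨ act-lin M (+ v) r (shift (δ o)) (λ _ → 1ℤ) i ⟩
    + v * actℤ M (shift (δ o)) i + r * actℤ M (λ _ → 1ℤ) i
      ≡⟨ cong₂ (λ a b → + v * a + r * b) (trans (act-shift (δ o) i) (cong (λ σ → s * shift (δ o) i + μ * σ) (sum-δ-row o))) (act-ones i) ⟩
    + v * (s * shift (δ o) i + μ * 1ℤ) + r * 0ℤ
      ≡⟨ solve 5 (λ v s h m r → v :* (s :* h :+ m :* con 1ℤ) :+ r :* con 0ℤ := s :* (v :* h) :+ m :* v) refl (+ v) s (shift (δ o) i) μ r ⟩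
    s * (+ v * shift (δ o) i) + μ * + v
      ≡⟨ cong (_+_ (s * (+ v * shift (δ o) i))) rs≡μv ⟨
    s * (+ v * shift (δ o) i) + r * s
      ≡⟨ solve 3 (λ s h r → s :* h :+ r :* s := s :* (h :+ r :* con 1ℤ)) refl s (+ v * shift (δ o) i) r ⟩
    s * special i ∎

  -- The p-part of the torsion for p not dividing r

  module AtPrime {p : ℕ} (p-prime : Prime p)
    (unit-r : LocalArithmetic.Unit p-prime r)
    {a γ : ℕ} {s' v' : ℤ}
    (s≡ : s ≡ s' * + (p ^ a)) (unit-s' : LocalArithmetic.Unit p-prime s')
    (v≡ : + v ≡ v' * + (p ^ γ)) (unit-v' : LocalArithmetic.Unit p-prime v')
    (γ≤a : γ ℕ.≤ a)
    where

    open LocalArithmetic p-prime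
    open LocalBases p-prime M s

    -- N is a unit and annihilates the prime-to-p part of the torsion, hence
    -- multiplication by N moves eigenvectors into K_p.
    N : ℤ
    N = r * s'

    Kp⇒sum-zero : ∀ {x} → InKp M p x → sumℤ v x ≡ 0ℤ
    Kp⇒sum-zero {x} (n , z , eq) = *-cancel-zero (pow n) (pow≢0 n) (begin
      pow n * sumℤ v x            ≡⟨ sum-* v (pow n) x ⟨
      sumℤ v (λ i → pow n * x i)  ≡⟨ sum-cong v eq ⟨
      sumℤ v (actℤ M z)           ≡⟨ image-sum z ⟩
      0ℤ                          ∎)

    N-pow-image : ∀ {x} → sumℤ v x ≡ 0ℤ → InImage M (λ i → N * (pow a * x i))
    N-pow-image {x} σ≡0 = image-cong M (λ i → begin
      r * s * x i             ≡⟨ cong (λ q → r * q * x i) s≡ ⟩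
      r * (s' * pow a) * x i  ≡⟨ solve 4 (λ r s p x → r :* (s :* p) :* x := r :* s :* (p :* x)) refl r s' (pow a) (x i) ⟩
      r * s' * (pow a * x i)  ∎) (rs-image σ≡0)

    -- Division by a unit D inside K_p: if D x and y agree modulo the image, then so do x and α y,
    -- where α inverts D modulo p^n.
    bézout-image : ∀ {D n} {x y : Vect v} → Unit D → InImage M (λ i → pow n * x i) →
      InImage M (λ i → D * x i - y i) → ∃ λ α → InImage M (λ i → x i - α * y i)
    bézout-image {D} {n} {x} {y} unit-D im-pow im-D with α , β , bz ← bézout-pow unit-D n =
      α , image-cong M (λ i → begin
        α * (D * x i - y i) + β * (pow n * x i)
          ≡⟨ solve 6 (λ a d x y b q → a :* (d :* x :- y) :+ b :* (q :* x) := (a :* d :+ b :* q) :* x :- a :* y) refl α D (x i) (y i) β (pow n) ⟩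
        (α * D + β * pow n) * x i - α * y i
          ≡⟨ cong (λ q → q * x i - α * y i) bz ⟩
        1ℤ * x i - α * y i
          ≡⟨ cong (_- α * y i) (ℤP.*-identityˡ (x i)) ⟩
        x i - α * y i ∎) (image-lin M α β im-D im-pow)

    -- Here K_p is killed by the unit rs, hence zero.
    trivialKp : Unit s → ∀ {g} {e : Fin g → ℕ} → (∀ i → e i ≡ 0) → IsoToKp M p e
    trivialKp unit-s {g} {e} e≡0 = (λ _ _ → 0ℤ) , (λ _ _ _ → refl) ,
      (λ _ → 0 , zero-image) ,
      (λ y _ i → subst (λ n → p ^ n ∣ ∣ y i ∣) (sym (e≡0 i)) (ℕD.1∣ ∣ y i ∣)) ,
      (λ _ _ → zero-image) ,
      λ x Kpx → (λ _ → 0ℤ) ,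
        let α , im = bézout-image {n = proj₁ Kpx} {y = λ _ → 0ℤ} (unit-* unit-r unit-s) (proj₂ Kpx)
                       (image-cong M (λ i → sym (ℤP.+-identityʳ (r * s * x i))) (rs-image (Kp⇒sum-zero Kpx)))
        in image-cong M (λ i → cong (λ q → x i - q) (ℤP.*-zeroʳ α)) im
      where
      zero-image : InImage M (λ _ → 0ℤ)
      zero-image = (λ _ → 0ℤ) , λ i → sum-zero v λ j → ℤP.*-zeroʳ (M i j)

    module _ (unit-s-r : Unit (s - r)) {n} {G : Fin n → Vect v} (B : LocalBasis G)
             (spans-generator : ∀ l → Spans (LocalBasis.vec B) P (generator l)) where

      open LocalBasis B using (size; eigenvector) renaming (vec to b)

      -- On an s-eigenvector `shift` is multiplication by the unit s - r, and its values are
      -- combinations of the generators.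
      spans-eigenvectors : ∀ x → Eigen M s x → Spans b P x
      spans-eigenvectors x ex with spanned u unit-u c z eq ← spans-lc x spans-generator =
        spanned (u * (s - r)) (unit-* unit-u unit-s-r) c z λ j → begin
          u * (s - r) * x j     ≡⟨ ℤP.*-assoc u (s - r) (x j) ⟩
          u * ((s - r) * x j)   ≡⟨ cong (u *_) (shift-eigen ex j) ⟨
          u * shift x j         ≡⟨ cong (u *_) (shift-generators (s-eigen⇒sum-zero ex) j) ⟩
          u * lc x generator j  ≡⟨ eq j ⟩
          lc c b j + P * z j    ∎

      size≡multiplicity : ∀ {g} → EigenMult M s g → size ≡ g
      size≡multiplicity mult with Y , eY , indY ← integralEigenvectors M s mult = ℕP.≤-antisym
        (ℕP.≮⇒≥ (independent⇒≤multiplicity M s mult b eigenvector (basis-independent B spans-eigenvectors)))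
        (ℕP.≮⇒≥ (independent⇒≤size B spans-eigenvectors Y eY indY))

      -- The two hypotheses bound the relations between the basis vectors from both sides. The
      -- second moves M z into the eigenlattice by `shift` and multiplies by v', the part of the
      -- denominator v prime to p; congruence modulo p^a suffices because no exponent exceeds a.
      module _ {e : Fin size → ℕ} (e≤a : ∀ i → e i ℕ.≤ a)
        (relations : ∀ i → InImage M (λ j → N * (pow (e i) * b i j)))
        (no-other-relations : ∀ z → ∃ λ (d : Vect size) → (∀ i → pow (e i) ∣ℤ d i) ×
           (∀ j → pow a ∣ℤ (v' * shift (actℤ M z) j - lc d b j)))
        where

        ψ : Vect size → Vect v
        ψ y j = N * lc y b j

        ψ-additive : ∀ y y' j → ψ (y +ᵥ y') j ≡ ψ y j + ψ y' j
        ψ-additive y y' j = trans (cong (N *_) (lc-+ y y' b j)) (ℤP.*-distribˡ-+ N (lc y b j) (lc y' b j))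

        ψ-Kp : ∀ y → InKp M p (ψ y)
        ψ-Kp y = a , image-cong M (λ i → solve 3 (λ n q l → n :* (q :* l) := q :* (n :* l)) refl N (pow a) (lc y b i))
          (N-pow-image (s-eigen⇒sum-zero (eigen-lc M y eigenvector)))

        -- If ψ y = M z, then v' (M - r) multiplies the combination of the y i by the unit U, while
        -- `no-other-relations` gives coefficients d i for the same vector modulo p^a. Independence
        -- modulo p^a compares the two.
        ψ-kernel-⊆ : ∀ y → InImage M (ψ y) → ∀ i → p ^ e i ∣ ∣ y i ∣
        ψ-kernel-⊆ y (z , eq) i with d , e∣d , a∣ ← no-other-relations z =
          S.∣⇒∣ᵤ (cancel-unit (unit-* unit-v' (unit-* (unit-* unit-r unit-s') unit-s-r)) (e i) (y i)
            (S.∣m+n∣n⇒∣m {m = U * y i} (S.∣-trans (pow-∣-pow (e≤a i)) (a∣c i)) (S.∣n⇒∣m*n (- 1ℤ) (e∣d i))))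
          where
          U : ℤ
          U = v' * (N * (s - r))

          c : Vect size
          c i = U * y i + (- 1ℤ) * d i

          shift-image : ∀ j → shift (actℤ M z) j ≡ N * (s - r) * lc y b j
          shift-image j = begin
            shift (actℤ M z) j
              ≡⟨ shift-cong eq j ⟩
            1ℤ * actℤ M (ψ y) j + (- r) * (N * lc y b j)
              ≡⟨ cong (λ q → 1ℤ * q + (- r) * (N * lc y b j)) (act-* M N (lc y b) j) ⟩
            1ℤ * (N * actℤ M (lc y b) j) + (- r) * (N * lc y b j)
              ≡⟨ cong (λ q → 1ℤ * (N * q) + (- r) * (N * lc y b j)) (act-eigen (eigen-lc M y eigenvector) j) ⟩
            1ℤ * (N * (s * lc y b j)) + (- r) * (N * lc y b j)
              ≡⟨ solve 4 (λ n s r l → con 1ℤ :* (n :* (s :* l)) :+ (:- r) :* (n :* l) := n :* (s :- r) :* l) refl N s r (lc y b j) ⟩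
            N * (s - r) * lc y b j ∎

          a∣c : ∀ i → pow a ∣ℤ c i
          a∣c = pow-∣-coefficients B spans-eigenvectors a c λ j → subst (pow a ∣ℤ_) (begin
            v' * shift (actℤ M z) j - lc d b j
              ≡⟨ cong (λ q → v' * q - lc d b j) (shift-image j) ⟩
            v' * (N * (s - r) * lc y b j) - lc d b j
              ≡⟨ solve 4 (λ v n l d → v :* (n :* l) :- d := v :* n :* l :+ (:- con 1ℤ) :* d) refl v' (N * (s - r)) (lc y b j) (lc d b j) ⟩
            U * lc y b j + (- 1ℤ) * lc d b j
              ≡⟨ cong₂ _+_ (lc-* U y b j) (lc-* (- 1ℤ) d b j) ⟨
            lc (λ i → U * y i) b j + lc (λ i → (- 1ℤ) * d i) b j
              ≡⟨ lc-+ (λ i → U * y i) (λ i → (- 1ℤ) * d i) b j ⟨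
            lc c b j ∎) (a∣ j)

        ψ-kernel-⊇ : ∀ y → (∀ i → p ^ e i ∣ ∣ y i ∣) → InImage M (ψ y)
        ψ-kernel-⊇ y e∣y = image-cong M (λ j → trans
            (sum-cong size λ i → trans
              (solve 4 (λ q n p b → q :* (n :* (p :* b)) := n :* ((q :* p) :* b)) refl (q i) N (pow (e i)) (b i j))
              (cong (λ t → N * (t * b i j)) (sym (S._∣_.equality (e∣ℤy i)))))
            (sum-* size N (λ i → y i * b i j)))
          (image-lc M q relations)
          where
          e∣ℤy : ∀ i → pow (e i) ∣ℤ y i
          e∣ℤy i = S.∣ᵤ⇒∣ (e∣y i)

          q : Vect size
          q i = S._∣_.quotient (e∣ℤy i)

        -- One has r (s - r) x = r (M - r) x + rs x - r M x, and the last two terms lie in the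
        -- image. The vector u (M - r) x is a combination of the basis plus p^a z, and N sends p^a z
        -- into the image. Hence D x is ψ (r c) modulo the image, and `bézout-image` removes D.
        ψ-surjective : ∀ x → InKp M p x → ∃ λ y → CokerEq M x (ψ y)
        ψ-surjective x Kpx
          with u , unit-u , c , z , ez , eq ← spans-pow B spans-eigenvectors a (shift x) (eigen-shift (Kp⇒sum-zero Kpx))
          = let α , im = bézout-image {n = proj₁ Kpx} {y = ψ (λ i → r * c i)} unit-D (proj₂ Kpx) im-D
            in (λ i → α * (r * c i)) , image-cong M (λ j → cong (λ q → x j - q) (begin
              α * (N * lc (λ i → r * c i) b j)        ≡⟨ solve 3 (λ a n l → a :* (n :* l) := n :* (a :* l)) refl α N (lc (λ i → r * c i) b j) ⟩
              N * (α * lc (λ i → r * c i) b j)        ≡⟨ cong (N *_) (lc-* α (λ i → r * c i) b j) ⟨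
              N * lc (λ i → α * (r * c i)) b j        ∎)) im
          where
          D : ℤ
          D = N * (r * (u * (s - r)))

          unit-D : Unit D
          unit-D = unit-* (unit-* unit-r unit-s') (unit-* unit-r (unit-* unit-u unit-s-r))

          im-D : InImage M (λ j → D * x j - ψ (λ i → r * c i) j)
          im-D = image-cong M (λ j → begin
              r * (N * (pow a * z j)) + N * u * (1ℤ * (r * s * x j) + (- r) * actℤ M x j)
                ≡⟨ solve 9 (λ r n q z u s x y l →
                     r :* (n :* (q :* z)) :+ n :* u :* (con 1ℤ :* (r :* s :* x) :+ (:- r) :* y)
                     := n :* (r :* (u :* (s :- r))) :* x :- n :* (r :* l) :+ n :* r :* ((l :+ q :* z) :- u :* (con 1ℤ :* y :+ (:- r) :* x))) refl
                     r N (pow a) (z j) u s (x j) (actℤ M x j) (lc c b j) ⟩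
              D * x j - N * (r * lc c b j) + N * r * ((lc c b j + pow a * z j) - u * shift x j)
                ≡⟨ cong (λ q → D * x j - N * (r * lc c b j) + N * r * q) (ℤP.i≡j⇒i-j≡0 (sym (eq j))) ⟩
              D * x j - N * (r * lc c b j) + N * r * 0ℤ
                ≡⟨ trans (cong (_+_ (D * x j - N * (r * lc c b j))) (ℤP.*-zeroʳ (N * r))) (ℤP.+-identityʳ (D * x j - N * (r * lc c b j))) ⟩
              D * x j - N * (r * lc c b j)
                ≡⟨ cong (λ q → D * x j - N * q) (lc-* r c b j) ⟨
              D * x j - ψ (λ i → r * c i) j ∎)
            (image-lin M r (N * u) (N-pow-image (s-eigen⇒sum-zero ez))
              (image-lin M 1ℤ (- r) (rs-image (Kp⇒sum-zero Kpx)) (x , λ _ → refl)))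

        isoToKp : IsoToKp M p e
        isoToKp = ψ , ψ-additive , ψ-Kp , ψ-kernel-⊆ , ψ-kernel-⊇ , ψ-surjective

    ε : ℤ
    ε = pow (a ∸ γ)

    pow-a≡ : pow a ≡ ε * pow γ
    pow-a≡ = trans (cong pow (sym (ℕP.m∸n+n≡m γ≤a))) (pow-+ (a ∸ γ) γ)

    -- This is rs = μv with p^γ cancelled: the exact power of p in μ is the exceptional one, a - γ.
    v'μ≡ : v' * μ ≡ ε * s' * r
    v'μ≡ = ℤP.*-cancelˡ-≡ (pow γ) (v' * μ) (ε * s' * r) {{ℤ.≢-nonZero (pow≢0 γ)}} (begin
      pow γ * (v' * μ)        ≡⟨ solve 3 (λ g v m → g :* (v :* m) := m :* (v :* g)) refl (pow γ) v' μ ⟩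
      μ * (v' * pow γ)        ≡⟨ cong (μ *_) v≡ ⟨
      μ * + v                 ≡⟨ rs≡μv ⟨
      r * s                   ≡⟨ cong (r *_) (trans s≡ (cong (s' *_) pow-a≡)) ⟩
      r * (s' * (ε * pow γ))  ≡⟨ solve 4 (λ r s e g → r :* (s :* (e :* g)) := g :* (e :* s :* r)) refl r s' ε (pow γ) ⟩
      pow γ * (ε * s' * r)    ∎)

    special-image : InImage M (λ j → N * (ε * special j))
    -- Since M kills constants, s `special` = v M (`shift (δ o)`). Cancelling p^γ gives s' ε
    -- `special` = M (v' `shift (δ o)`), and the factor r completes s' to N.
    special-image = (λ j → r * v' * shift (δ o) j) , λ j → begin
      actℤ M (λ j → r * v' * shift (δ o) j) j
        ≡⟨ trans (act-* M (r * v') (shift (δ o)) j) (cong (r * v' *_) (trans (act-shift (δ o) j) (cong (λ σ → s * shift (δ o) j + μ * σ) (sum-δ-row o)))) ⟩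
      r * v' * (s * shift (δ o) j + μ * 1ℤ)
        ≡⟨ solve 5 (λ r v s h m → r :* v :* (s :* h :+ m :* con 1ℤ) := r :* (v :* s :* h :+ v :* m)) refl r v' s (shift (δ o) j) μ ⟩
      r * (v' * s * shift (δ o) j + v' * μ)
        ≡⟨ cong₂ (λ t m → r * (v' * t * shift (δ o) j + m)) (trans s≡ (cong (s' *_) pow-a≡)) v'μ≡ ⟩
      r * (v' * (s' * (ε * pow γ)) * shift (δ o) j + ε * s' * r)
        ≡⟨ solve 6 (λ r v s e g h → r :* (v :* (s :* (e :* g)) :* h :+ e :* s :* r) := r :* s :* (e :* (v :* g :* h :+ r :* con 1ℤ))) refl r v' s' ε (pow γ) (shift (δ o) j) ⟩
      N * (ε * (v' * pow γ * shift (δ o) j + r * 1ℤ))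
        ≡⟨ cong (λ t → N * (ε * (t * shift (δ o) j + r * 1ℤ))) v≡ ⟨
      N * (ε * special j) ∎

    -- Only the sum σ of z matters modulo p^a: z - σ δ o has sum zero, so `shift` of its image under
    -- M is s times an integral vector, and δ o contributes the multiple of `special`.
    shift-image-special : ∀ z j →
      pow a ∣ℤ (v' * shift (actℤ M z) j - sumℤ v z * (ε * s') * special j)
    shift-image-special z j = divides (s' * v' * (shift z j - sumℤ v z * shift (δ o) j)) (begin
      v' * shift (actℤ M z) j - sumℤ v z * (ε * s') * special j
        ≡⟨ cong₂ (λ t w → v' * t - sumℤ v z * (ε * s') * (w * shift (δ o) j + r * 1ℤ)) (shift-act z j) v≡ ⟩
      v' * (s * shift z j + μ * σ) - σ * (ε * s') * (v' * pow γ * h + r * 1ℤ)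
        ≡⟨ solve 10 (λ v s y m σ e t g h r →
             v :* (s :* y :+ m :* σ) :- σ :* (e :* t) :* (v :* g :* h :+ r :* con 1ℤ)
             := v :* s :* y :+ σ :* (v :* m) :- σ :* (e :* t :* r) :- σ :* t :* v :* (e :* g) :* h) refl
             v' s (shift z j) μ σ ε s' (pow γ) h r ⟩
      v' * s * shift z j + σ * (v' * μ) - σ * (ε * s' * r) - σ * s' * v' * (ε * pow γ) * h
        ≡⟨ cong₂ (λ m q → v' * s * shift z j + σ * m - σ * (ε * s' * r) - σ * s' * v' * q * h) v'μ≡ (sym pow-a≡) ⟩
      v' * s * shift z j + σ * (ε * s' * r) - σ * (ε * s' * r) - σ * s' * v' * pow a * h
        ≡⟨ cong (λ t → v' * t * shift z j + σ * (ε * s' * r) - σ * (ε * s' * r) - σ * s' * v' * pow a * h) s≡ ⟩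
      v' * (s' * pow a) * shift z j + σ * (ε * s' * r) - σ * (ε * s' * r) - σ * s' * v' * pow a * h
        ≡⟨ solve 7 (λ v t q y m σ h → v :* (t :* q) :* y :+ m :- m :- σ :* t :* v :* q :* h := t :* v :* (y :- σ :* h) :* q) refl
             v' s' (pow a) (shift z j) (σ * (ε * s' * r)) σ h ⟩
      s' * v' * (shift z j - σ * h) * pow a ∎)
      where
      σ h : ℤ
      σ = sumℤ v z
      h = shift (δ o) j

    targetExp≤ : ∀ {n} (i : Fin n) → targetExp a γ i ℕ.≤ a
    targetExp≤ zero    = ℕP.m∸n≤m a γ
    targetExp≤ (suc i) = ℕP.≤-refl

    isoToKp-coprime : ∀ {g} → Unit (s - r) → γ ≡ 0 → EigenMult M s g → IsoToKp {g = g} M p (targetExp a γ)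
    isoToKp-coprime unit-s-r γ≡0 mult =
      subst (λ n → IsoToKp {g = n} M p (targetExp a γ)) (size≡multiplicity unit-s-r B spans mult)
        (isoToKp unit-s-r B spans targetExp≤
          (λ i → subst (λ n → InImage M (λ j → N * (pow n * vec i j))) (sym (targetExp≡a i))
                   (N-pow-image (s-eigen⇒sum-zero (eigenvector i))))
          (λ z → (λ _ → 0ℤ) , (λ i → divides 0ℤ refl) , λ j →
            S.∣m∣n⇒∣m-n (S.∣m+n∣n⇒∣m {m = v' * shift (actℤ M z) j} (shift-image-special z j) (pow-a∣special z j))
              (divides 0ℤ (lc-zero vec (λ _ → refl) j))))
      where
      B : LocalBasis generator
      B = basis v generator generator-eigen

      open LocalBasis B

      a∸γ≡a : a ∸ γ ≡ a
      a∸γ≡a = cong (a ∸_) γ≡0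

      targetExp≡a : ∀ {n} (i : Fin n) → targetExp a γ i ≡ a
      targetExp≡a zero    = a∸γ≡a
      targetExp≡a (suc i) = refl

      pow-a∣special : ∀ z j → pow a ∣ℤ (- (sumℤ v z * (ε * s') * special j))
      pow-a∣special z j = S.∣m⇒∣-m (S.∣m⇒∣m*n (special j) (S.∣n⇒∣m*n (sumℤ v z) (S.∣m⇒∣m*n s'
        (S.∣-reflexive (cong pow (sym a∸γ≡a))))))

    isoToKp-ramified : ∀ {g} → Unit (s - r) → P ∣ℤ (+ v) → EigenMult M s g → IsoToKp {g = g} M p (targetExp a γ)
    isoToKp-ramified unit-s-r P∣v mult =
      subst (λ n → IsoToKp {g = n} M p (targetExp a γ)) (size≡multiplicity unit-s-r B (spans ∘ suc) mult)
        (isoToKp unit-s-r B (spans ∘ suc) targetExp≤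
          (λ { zero → special-image ; (suc i) → N-pow-image (s-eigen⇒sum-zero (eigenvector (suc i))) })
          (λ z → (sumℤ v z * (ε * s') ∷ λ _ → 0ℤ) ,
            (λ { zero → S.∣n⇒∣m*n (sumℤ v z) (S.∣m⇒∣m*n s' S.∣-refl) ; (suc i) → divides 0ℤ refl }) ,
            λ j → subst (λ w → pow a ∣ℤ (v' * shift (actℤ M z) j - w)) (sym (lc-special z j)) (shift-image-special z j)))
      where
      -- As p divides v, every entry of `special` is r modulo p.
      unit-special : Unit (special o)
      unit-special P∣special = unit-r (subst (P ∣ℤ_) (ℤP.*-identityʳ r)
        (S.∣m+n∣m⇒∣n P∣special (S.∣m⇒∣m*n (shift (δ o) o) P∣v)))

      B : LocalBasis (special ∷ generator)
      -- With `special` at the head, index zero carries the exponent a - γ, as in `targetExp`.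
      B = extend special o special-eigen unit-special
        (basis v (eliminate special o generator)
          λ i → eigen-lin M (special o) (- generator i o) (generator-eigen i) special-eigen)

      open LocalBasis B

      lc-special : ∀ z j → lc (sumℤ v z * (ε * s') ∷ λ _ → 0ℤ) vec j ≡ sumℤ v z * (ε * s') * special j
      lc-special z j = trans
        (cong (_+_ (sumℤ v z * (ε * s') * special j)) (lc-zero (vec ∘ suc) (λ _ → refl) j))
        (ℤP.+-identityʳ (sumℤ v z * (ε * s') * special j))

-- Application to strongly regular graphs

exactPow-cofactor : ∀ {p} (p-prime : Prime p) i z → ExactPow p i ∣ z ∣ →
  let open LocalArithmetic p-prime in ∃ λ z' → z ≡ z' * pow i × Unit z'
exactPow-cofactor {p} p-prime i z (p^i∣z , p^1+i∤z) with divides z' eq ← S.∣ᵤ⇒∣ {+ (p ^ i)} {z} p^i∣z =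
  z' , eq , λ P∣z' → p^1+i∤z (S.∣⇒∣ᵤ (subst (_∣ℤ z) (sym (pow-suc i))
    (subst (P * pow i ∣ℤ_) (sym eq) (S.*-monoˡ-∣ (pow i) P∣z'))))
  where open LocalArithmetic p-prime

-- The interchanged statement is the instance with r, s and f, g exchanged.
theorem3p1 : ∀ {v k λ' μ : ℕ} (Γ : Graph v) → IsSRG Γ k λ' μ → Connected Γ →
    ∀ (r s : ℤ) (f g : ℕ) → r ≢ + 0 → s ≢ + 0 → r ≢ s → 0 < f → 0 < g →
    EigenMult (laplacian Γ k) r f → EigenMult (laplacian Γ k) s g →
    ∀ (p : ℕ) → Prime p → ∀ (n : ℕ) → HasOrder (laplacian Γ k) n → p ∣ n →
    ¬ (p ∣ ∣ r ∣) →
    ∀ (a γ : ℕ) → ExactPow p a ∣ s ∣ → ExactPow p γ v →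
    IsoToKp {g = g} (laplacian Γ k) p (targetExp a γ)
theorem3p1 {zero} Γ srg _ r s f g r≢0 s≢0 r≢s _ _ multr mults p p-prime _ _ _ p∤r a γ _ (_ , p^1+γ∤v) =
  contradiction ((p ^ suc γ) ℕD.∣0) p^1+γ∤v
theorem3p1 {v@(suc _)} {k} {λ'} {μ} Γ srg _ r s (suc f) (suc g) r≢0 s≢0 r≢s _ _ multr mults p p-prime _ _ _ p∤r a γ exact-s exact-v
  with s' , s≡ , unit-s' ← exactPow-cofactor p-prime a s exact-s
     | v' , v≡ , unit-v' ← exactPow-cofactor p-prime γ (+ v) exact-v
  = split a γ refl refl
  where
  open StronglyRegular Γ srg
  open LocalArithmetic p-prime

  root : ∀ {θ f} → θ ≢ 0ℤ → EigenMult L θ (suc f) → θ * θ - t * θ + q ≡ 0ℤ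
  root {θ} θ≢0 mult with Y , eY , indY ← integralEigenvectors L θ mult =
    eigenvalue-root θ≢0 (eY zero) (independent⇒nonzero {b = Y} indY)

  t≡ : t ≡ r + s
  t≡ = proj₁ (vieta r≢s (root r≢0 multr) (root s≢0 mults))

  q≡ : q ≡ r * s
  q≡ = proj₂ (vieta {t = t} r≢s (root r≢0 multr) (root s≢0 mults))

  rs≡μv : r * s ≡ + μ * + v
  rs≡μv = trans (sym q≡) (q≡μv zero)

  unit-r : Unit r
  unit-r = p∤r ∘ S.∣⇒∣ᵤ

  -- By rs = μv, p^γ divides rs, hence s; so `a ∸ γ` is a genuine difference.
  γ≤a : γ ℕ.≤ a
  γ≤a = ℕP.≮⇒≥ λ a<γ → proj₂ exact-s (S.∣⇒∣ᵤ (S.∣-trans (pow-∣-pow a<γ)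
    (cancel-unit unit-r γ s (subst (pow γ ∣ℤ_) (sym rs≡μv) (S.∣n⇒∣m*n (+ μ) (divides v' v≡))))))

  open TwoEigenvalues L r s (+ μ) laplacian-sum laplacian-ones
    (λ x i → trans (laplacian-square x i) (cong₂ (λ t q → t * actℤ L x i - q * x i + + μ * sumℤ v x) t≡ q≡))
    rs≡μv s≢0 zero
  open AtPrime p-prime unit-r s≡ unit-s' v≡ unit-v' γ≤a

  P∣pow : ∀ n → P ∣ℤ pow (suc n)
  P∣pow n = divides (pow n) (trans (pow-suc n) (ℤP.*-comm P (pow n)))

  -- For a positive, s - r is -r modulo p.
  unit-s-r : ∀ {a'} → a ≡ suc a' → Unit (s - r)
  unit-s-r {a'} a≡ P∣s-r = unit-r (subst (P ∣ℤ_) (solve 2 (λ s r → s :- (s :- r) := r) refl s r)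
    (S.∣m∣n⇒∣m-n (subst (P ∣ℤ_) (sym s≡) (S.∣n⇒∣m*n s' (subst (λ n → P ∣ℤ pow n) (sym a≡) (P∣pow a')))) P∣s-r))

  -- The cases are p prime to s, p dividing s but not v, and p dividing both. Copies of a and γ are
  -- matched, so that the opened modules keep their parameters.
  split : ∀ a' γ' → a ≡ a' → γ ≡ γ' → IsoToKp {g = suc g} L p (targetExp a γ)
  split zero γ' a≡0 _ = trivialKp
    (λ P∣s → proj₂ exact-s (subst (λ n → p ^ suc n ∣ ∣ s ∣) (sym a≡0) (subst (_∣ ∣ s ∣) (sym (ℕP.*-identityʳ p)) (S.∣⇒∣ᵤ P∣s))))
    (λ i → ℕP.n≤0⇒n≡0 (ℕP.≤-trans (targetExp≤ i) (ℕP.≤-reflexive a≡0)))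
  split (suc a') zero a≡ γ≡0 = isoToKp-coprime (unit-s-r a≡) γ≡0 mults
  split (suc a') (suc γ') a≡ γ≡ = isoToKp-ramified (unit-s-r a≡)
    (subst (P ∣ℤ_) (sym v≡) (S.∣n⇒∣m*n v' (subst (λ n → P ∣ℤ pow n) (sym γ≡) (P∣pow γ')))) mults
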